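{- For every $d\ge 1$ there exist sets $S_1,\ldots,S_{d+1}\subseteq\mathbb{R}^d$ of $d+1$ points each and a point $p$ in the interior of the core $\bigcap_{i=1}^{d+1}\operatorname{conv}(S_i)$, in general position with respect to $S_1\cup\cdots\cup S_{d+1}$, such that $p$ lies in exactly $d^{d+1}+1$ colourful simplices. In particular $\nu(d)\ge d^{d+1}+1$.
   Context: A finite set of points in $\mathbb{R}^d$ is in general position if for every $k<d$, no $k$-dimensional affine subspace contains $k+2$ of its points. A colourful simplex of $(S_1,\ldots,S_{d+1})$ is $\operatorname{conv}(x_1,\ldots,x_{d+1})$ with $x_i\in S_i$ for each $i$. $\nu(d)$ is the maximum, over all configurations of $d+1$ points in each of $d+1$ colours in $\mathbb{R}^d$ and all points $p$ in the interior of their core, of the number of colourful simplices containing $p$. -}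

module Defs where

open import Data.Nat using (ℕ; zero; suc) renaming (_+_ to _+ℕ_)
open import Data.Fin using (Fin; zero; suc)
open import Data.Rational using (ℚ; 0ℚ; 1ℚ; _+_; _*_; _-_; _≤_; _<_; ∣_∣)
open import Data.Product using (Σ; ∃; _×_; _,_)
open import Relation.Binary.PropositionalEquality using (_≡_)
open import Relation.Nullary using (¬_)
open import Function.Definitions using (Injective)

-- A point of ℚ^d (rational model of ℝ^d), as a function on coordinates.
Point : ℕ → Set
Point d = Fin d → ℚ

∑ : ∀ {m} → (Fin m → ℚ) → ℚ
∑ {zero}  f = 0ℚ
∑ {suc m} f = f zero + ∑ (λ j → f (suc j))

_∈Conv_ : ∀ {d m} → Point d → (Fin m → Point d) → Set
_∈Conv_ {d} {m} q y =
  Σ (Fin m → ℚ) λ λs →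
    (∀ j → 0ℚ ≤ λs j) × (∑ λs ≡ 1ℚ) × (∀ t → ∑ (λ j → λs j * y j t) ≡ q t)

InFlat : ∀ {d k} → Point d → (Fin k → Point d) → Point d → Set
InFlat {d} {k} a v q =
  Σ (Fin k → ℚ) λ μ → ∀ t → q t ≡ a t + ∑ (λ l → μ l * v l t)

GeneralPosition : ∀ {d} {I : Set} → (I → Point d) → Set
GeneralPosition {d} {I} z =
  ∀ k → k Data.Nat.< d → (ι : Fin (k +ℕ 2) → I) → Injective _≡_ _≡_ ι →
    ¬ (Σ (Point d) λ a → Σ (Fin k → Point d) λ v → ∀ j → InFlat a v (z (ι j)))

InInteriorOfCore : ∀ {d c m} → Point d → (Fin c → Fin m → Point d) → Set
InInteriorOfCore {d} p x =
  Σ ℚ λ ε → (0ℚ < ε) ×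
    (∀ (q : Point d) → (∀ t → ∣ q t - p t ∣ < ε) → ∀ i → q ∈Conv (x i))

open import Data.Maybe using (Maybe; just; nothing)

withPoint : ∀ {d c m} → Point d → (Fin c → Fin m → Point d) → Maybe (Fin c × Fin m) → Point d
withPoint p x nothing = p
withPoint p x (just (i , j)) = x i j

-- In the hyperplane Σ y = 0 of ℚ^(d+1) the vectors V i = (d+1) e_i − 𝟙 are the vertices of a simplex around
-- the origin.  Colour i consists of the point −K V i and d points (K−1) V i + V j (j ≠ i) clustered near K V i.
-- A colourful choice c therefore surrounds the origin when c has no fixed point (one point near each K V i)
-- and when c is the identity (the points −K V i); when c fixes some colours and moves others, the sum of the
-- coordinates of the moved colours is positive on every chosen point.  This gives d^(d+1) + 1 simplices.  The
-- barycentric coordinates of the origin with respect to every colour are bounded away from 0, so it is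
-- interior to the core.  All of this survives a small perturbation, because affine coordinates with respect
-- to a perturbed simplex are close to those with respect to the original one.  Perturbing the integer ideal
-- points along the moment curve, by (ν, ν², …, ν^d)/q with distinct nodes ν and q = 1 + N!·R, puts them and
-- the origin in general position: an affine dependence would give integer dependences divisible by ever
-- higher powers of q.

module Submission where

open import Defs

module RationalGeometry where

  open import Level using (0ℓ)
  open import Data.Nat as ℕ using (ℕ; zero; suc; z≤n; s≤s; _!)
  import Data.Nat.Divisibility as ℕ
  import Data.Nat.Properties as ℕ
  import Data.Nat.Tactic.RingSolver as ℕ-Solver
  open import Data.Integer as ℤ using (ℤ)
  import Data.Integer.Properties as ℤ
  open import Algebra.Properties.AbelianGroup ℤ.+-0-abelianGroup
    using () renaming (inverseʳ-unique to ℤ-inverseʳ-unique)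
  import Data.Integer.Tactic.RingSolver as ℤ-Solver
  import Data.Rational as ℚ
  open import Data.Rational
    using (ℚ; 0ℚ; 1ℚ; ½; _+_; _*_; _-_; -_; 1/_; _≤_; _<_; ∣_∣; NonZero; nonNegative; ≢-nonZero)
  open import Data.Rational.Properties
  import Data.Rational.Unnormalised as ℚᵘ
  import Data.Rational.Unnormalised.Properties as ℚᵘ
  open import Data.Rational.Literals using (fromℤ)
  open import Data.Fin as Fin using (Fin; zero; suc; punchIn; toℕ; fromℕ<)
  open import Data.Fin.Properties
    using (any?; suc-injective; toℕ-fromℕ<; cast-involutive; toℕ-injective; toℕ<n; combine-injective;
           punchIn-punchOut; punchInᵢ≢i; punchIn-injective; all?; ¬∀⟶∃¬)
  open import Data.Integer.Divisibility.Signed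
    using (_∣_; divides; ∣-refl; ∣m∣n⇒∣m+n; ∣m⇒∣-m; ∣n⇒∣m*n; ∣m⇒∣m*n; ∣m+n∣n⇒∣m; ∣ᵤ⇒∣; ∣⇒∣ᵤ)
  open import Data.Integer.Coprimality using (Coprime; coprime-divisor)
  open import Data.Vec.Functional using (insertAt) renaming (_∷_ to _◂_)
  open import Data.Vec.Functional.Properties using (insertAt-lookup; insertAt-punchIn)
  open import Data.Product using (Σ; ∃; _×_; _,_; proj₁; proj₂)
  open import Data.Maybe using (Maybe; just; nothing)
  import Data.List as List
  open import Data.List using (List; []; _∷_; _++_; length; cartesianProductWith)
  open import Data.List.Properties using (length-++; length-map; length-tabulate)
  open import Data.List.Membership.Propositional using (_∈_)
  open import Data.List.Membership.Propositional.Properties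
    using (∈-cartesianProductWith⁺; ∈-cartesianProductWith⁻; ∈-map⁺; ∈-map⁻; ∈-allFin; ∈-++⁺ˡ; ∈-++⁺ʳ; ∈-++⁻)
  open import Data.List.Relation.Unary.Any using (here)
  open import Data.List.Relation.Unary.AllPairs using ([]; _∷_)
  open import Data.List.Relation.Unary.All using ([])
  open import Data.List.Relation.Unary.Unique.Propositional using (Unique)
  import Data.List.Relation.Unary.Unique.Propositional.Properties as Unique
  open import Data.Vec using (Vec; []; _∷_; lookup; allFin)
  open import Data.Vec.Properties using (∷-injective; tabulate∘lookup; tabulate-cong; lookup-allFin)
  open import Data.Sum using (_⊎_; inj₁; inj₂; [_,_]′)
  open import Data.Empty using (⊥-elim)
  open import Function using (_∘_; id)
  open import Function.Bundles using (_⇔_; mk⇔)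
  open import Relation.Binary.PropositionalEquality
    using (_≡_; _≢_; refl; sym; trans; cong; cong₂; subst; module ≡-Reasoning)
  open import Relation.Nullary using (¬_; yes; no; ¬?)
  open import Relation.Nullary.Decidable using (dec⇒maybe; decidable-stable; toSum)
  open import Tactic.RingSolver using (solve-∀)
  open import Tactic.RingSolver.Core.AlmostCommutativeRing
    using (AlmostCommutativeRing; fromCommutativeRing)
  open import Algebra.Bundles using (CommutativeRing)
  import Algebra.Properties.Semiring.Sum as Sum
  open import Algebra.Properties.Group +-0-group
    using (inverseˡ-unique; inverseʳ-unique) renaming (⁻¹-involutive to neg-involutive)
  open Sum (CommutativeRing.semiring +-*-commutativeRing)
    using (sum; sum-syntax; sum-cong-≗; ∑-distrib-+; ∑-comm; *-distribˡ-sum; *-distribʳ-sum;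
           sum-remove; sum-replicate-zero)

  -- Rational arithmetic
  ℚ-ring : AlmostCommutativeRing 0ℓ 0ℓ
  ℚ-ring = fromCommutativeRing +-*-commutativeRing (λ x → dec⇒maybe (0ℚ ≟ x))

  cong₃ : ∀ {A B C D : Set} (f : A → B → C → D) {a a′ b b′ c c′} →
          a ≡ a′ → b ≡ b′ → c ≡ c′ → f a b c ≡ f a′ b′ c′
  cong₃ f refl refl refl = refl

  fromℤ-injective : ∀ {a b} → fromℤ a ≡ fromℤ b → a ≡ b
  fromℤ-injective = cong ℚ.numerator

  fromℤ-homo-+ : ∀ a b → fromℤ (a ℤ.+ b) ≡ fromℤ a + fromℤ b
  fromℤ-homo-+ a b =
    toℚᵘ-injective (ℚᵘ.≃-trans (ℚᵘ.*≡* (cross a b)) (ℚᵘ.≃-sym (toℚᵘ-homo-+ (fromℤ a) (fromℤ b))))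
    where
    cross : ∀ a b → (a ℤ.+ b) ℤ.* ℤ.+ 1 ≡ (a ℤ.* ℤ.+ 1 ℤ.+ b ℤ.* ℤ.+ 1) ℤ.* ℤ.+ 1
    cross = ℤ-Solver.solve-∀

  fromℤ-homo-* : ∀ a b → fromℤ (a ℤ.* b) ≡ fromℤ a * fromℤ b
  fromℤ-homo-* a b =
    toℚᵘ-injective (ℚᵘ.≃-trans (ℚᵘ.*≡* refl) (ℚᵘ.≃-sym (toℚᵘ-homo-* (fromℤ a) (fromℤ b))))

  fromℕ : ℕ → ℚ
  fromℕ n = fromℤ (ℤ.+ n)

  fromℕ-homo-+ : ∀ m n → fromℕ (m ℕ.+ n) ≡ fromℕ m + fromℕ n
  fromℕ-homo-+ m n = fromℤ-homo-+ (ℤ.+ m) (ℤ.+ n)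

  fromℕ-homo-* : ∀ m n → fromℕ (m ℕ.* n) ≡ fromℕ m * fromℕ n
  fromℕ-homo-* m n = trans (cong fromℤ (ℤ.pos-* m n)) (fromℤ-homo-* (ℤ.+ m) (ℤ.+ n))

  fromℕ-*-assoc : ∀ a b r → fromℕ a * (fromℕ b * r) ≡ fromℕ (a ℕ.* b) * r
  fromℕ-*-assoc a b r = trans (sym (*-assoc (fromℕ a) (fromℕ b) r)) (cong (_* r) (sym (fromℕ-homo-* a b)))

  fromℕ-mono-≤ : ∀ {m n} → m ℕ.≤ n → fromℕ m ≤ fromℕ n
  fromℕ-mono-≤ {m} {n} m≤n = ℚ.*≤* (ℤ.*-monoʳ-≤-nonNeg (ℤ.+ 1) (ℤ.+≤+ m≤n))

  0≤fromℕ : ∀ n → 0ℚ ≤ fromℕ n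
  0≤fromℕ n = fromℕ-mono-≤ z≤n

  1/ℕ : (n : ℕ) → .{{ℕ.NonZero n}} → ℚ
  1/ℕ n = 1/ fromℕ n

  n*1/n≡1 : ∀ n .{{_ : ℕ.NonZero n}} → fromℕ n * 1/ℕ n ≡ 1ℚ
  n*1/n≡1 n = *-inverseʳ (fromℕ n)

  0≤1/ℕ : ∀ n .{{_ : ℕ.NonZero n}} → 0ℚ ≤ 1/ℕ n
  0≤1/ℕ (suc n) = nonNegative⁻¹ _

  inverse-unique : ∀ p {x y} → x * p ≡ 1ℚ → p * y ≡ 1ℚ → x ≡ y
  inverse-unique p {x} {y} xp≡1 py≡1 = begin
    x           ≡⟨ *-identityʳ x ⟨
    x * 1ℚ      ≡⟨ cong (x *_) py≡1 ⟨
    x * (p * y) ≡⟨ *-assoc x p y ⟨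
    x * p * y   ≡⟨ cong (_* y) xp≡1 ⟩
    1ℚ * y      ≡⟨ *-identityˡ y ⟩
    y           ∎
    where open ≡-Reasoning

  1/ℕ-homo-* : ∀ m n .{{_ : ℕ.NonZero m}} .{{_ : ℕ.NonZero n}} →
               1/ℕ (m ℕ.* n) {{ℕ.m*n≢0 m n}} ≡ 1/ℕ m * 1/ℕ n
  1/ℕ-homo-* m n = inverse-unique (fromℕ (m ℕ.* n)) (*-inverseˡ (fromℕ (m ℕ.* n)) {{ℕ.m*n≢0 m n}}) (begin
    fromℕ (m ℕ.* n) * (1/ℕ m * 1/ℕ n)          ≡⟨ cong (_* (1/ℕ m * 1/ℕ n)) (fromℕ-homo-* m n) ⟩
    fromℕ m * fromℕ n * (1/ℕ m * 1/ℕ n)        ≡⟨ regroup (fromℕ m) (fromℕ n) (1/ℕ m) (1/ℕ n) ⟩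
    (fromℕ m * 1/ℕ m) * (fromℕ n * 1/ℕ n)      ≡⟨ cong₂ _*_ (n*1/n≡1 m) (n*1/n≡1 n) ⟩
    1ℚ                                          ∎)
    where
    open ≡-Reasoning
    regroup : ∀ a b x y → a * b * (x * y) ≡ (a * x) * (b * y)
    regroup = solve-∀ ℚ-ring

  *-1/ℕ-cancel : ∀ a c .{{_ : ℕ.NonZero a}} .{{_ : ℕ.NonZero c}} →
                 fromℕ a * 1/ℕ (a ℕ.* c) {{ℕ.m*n≢0 a c}} ≡ 1/ℕ c
  *-1/ℕ-cancel a c = begin
    fromℕ a * 1/ℕ (a ℕ.* c) {{ℕ.m*n≢0 a c}} ≡⟨ cong (fromℕ a *_) (1/ℕ-homo-* a c) ⟩
    fromℕ a * (1/ℕ a * 1/ℕ c)               ≡⟨ *-assoc (fromℕ a) (1/ℕ a) (1/ℕ c) ⟨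
    fromℕ a * 1/ℕ a * 1/ℕ c                 ≡⟨ cong (_* 1/ℕ c) (n*1/n≡1 a) ⟩
    1ℚ * 1/ℕ c                              ≡⟨ *-identityˡ (1/ℕ c) ⟩
    1/ℕ c                                   ∎
    where open ≡-Reasoning

  p*r≡0⇒p≡0 : ∀ {p} r .{{_ : NonZero r}} → p * r ≡ 0ℚ → p ≡ 0ℚ
  p*r≡0⇒p≡0 {p} r pr≡0 = begin
    p                ≡⟨ *-identityʳ p ⟨
    p * 1ℚ           ≡⟨ cong (p *_) (*-inverseʳ r) ⟨
    p * (r * 1/ r)   ≡⟨ *-assoc p r (1/ r) ⟨
    p * r * 1/ r     ≡⟨ cong (_* 1/ r) pr≡0 ⟩
    0ℚ * 1/ r        ≡⟨ *-zeroˡ (1/ r) ⟩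
    0ℚ               ∎
    where open ≡-Reasoning

  *-monoʳ-≤-0≤ : ∀ {r p q} → 0ℚ ≤ r → p ≤ q → p * r ≤ q * r
  *-monoʳ-≤-0≤ {r} 0≤r = *-monoʳ-≤-nonNeg r {{nonNegative 0≤r}}

  *-monoˡ-≤-0≤ : ∀ {r p q} → 0ℚ ≤ r → p ≤ q → r * p ≤ r * q
  *-monoˡ-≤-0≤ {r} 0≤r = *-monoˡ-≤-nonNeg r {{nonNegative 0≤r}}

  0≤* : ∀ {p q} → 0ℚ ≤ p → 0ℚ ≤ q → 0ℚ ≤ p * q
  0≤* {p} {q} 0≤p 0≤q = ≤-trans (≤-reflexive (sym (*-zeroˡ q))) (*-monoʳ-≤-0≤ 0≤q 0≤p)

  a*c≤b⇒a/b≤1/c : ∀ a b c .{{_ : ℕ.NonZero b}} .{{_ : ℕ.NonZero c}} →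
                  a ℕ.* c ℕ.≤ b → fromℕ a * 1/ℕ b ≤ 1/ℕ c
  a*c≤b⇒a/b≤1/c a b c ac≤b = begin
    fromℕ a * 1/ℕ b                          ≡⟨ regroup (fromℕ a) (1/ℕ b) (fromℕ c) (1/ℕ c) (n*1/n≡1 c) ⟩
    fromℕ a * fromℕ c * (1/ℕ b * 1/ℕ c)      ≡⟨ cong (_* (1/ℕ b * 1/ℕ c)) (fromℕ-homo-* a c) ⟨
    fromℕ (a ℕ.* c) * (1/ℕ b * 1/ℕ c)        ≤⟨ *-monoʳ-≤-0≤ (0≤* (0≤1/ℕ b) (0≤1/ℕ c)) (fromℕ-mono-≤ ac≤b) ⟩
    fromℕ b * (1/ℕ b * 1/ℕ c)                ≡⟨ *-assoc (fromℕ b) (1/ℕ b) (1/ℕ c) ⟨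
    fromℕ b * 1/ℕ b * 1/ℕ c                  ≡⟨ cong (_* 1/ℕ c) (n*1/n≡1 b) ⟩
    1ℚ * 1/ℕ c                               ≡⟨ *-identityˡ (1/ℕ c) ⟩
    1/ℕ c                                    ∎
    where
    open ≤-Reasoning
    regroup : ∀ a y c x → c * x ≡ 1ℚ → a * y ≡ a * c * (y * x)
    regroup a y c x cx≡1 = begin-equality
      a * y                ≡⟨ *-identityʳ (a * y) ⟨
      a * y * 1ℚ           ≡⟨ cong (a * y *_) cx≡1 ⟨
      a * y * (c * x)      ≡⟨ swap a y c x ⟩
      a * c * (y * x)      ∎
      where
      swap : ∀ a y c x → a * y * (c * x) ≡ a * c * (y * x)
      swap = solve-∀ ℚ-ring

  1/ℕ≤1 : ∀ m .{{_ : ℕ.NonZero m}} → 1/ℕ m ≤ 1ℚ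
  1/ℕ≤1 m = ≤-trans (≤-reflexive (sym (*-identityˡ (1/ℕ m)))) (a*c≤b⇒a/b≤1/c 1 m 1 (ℕ.>-nonZero⁻¹ m))

  p≤∣p∣ : ∀ p → p ≤ ∣ p ∣
  p≤∣p∣ p with ∣p∣≡p∨∣p∣≡-p p
  ... | inj₁ ∣p∣≡p  = ≤-reflexive (sym ∣p∣≡p)
  ... | inj₂ ∣p∣≡-p = ≤-trans p≤0 (0≤∣p∣ p)
    where
    p≤0 : p ≤ 0ℚ
    p≤0 = ≤-trans (≤-reflexive (sym (neg-involutive p)))
                  (neg-antimono-≤ (≤-trans (0≤∣p∣ p) (≤-reflexive ∣p∣≡-p)))

  -p≤∣p∣ : ∀ p → - p ≤ ∣ p ∣
  -p≤∣p∣ p = ≤-trans (p≤∣p∣ (- p)) (≤-reflexive (∣-p∣≡∣p∣ p))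

  ∣p-q∣≤r⇒q-r≤p : ∀ {p q r} → ∣ p - q ∣ ≤ r → q - r ≤ p
  ∣p-q∣≤r⇒q-r≤p {p} {q} {r} ∣p-q∣≤r = begin
    q - r                ≤⟨ +-monoʳ-≤ q (neg-antimono-≤ (≤-trans (-p≤∣p∣ (p - q)) ∣p-q∣≤r)) ⟩
    q + - - (p - q)      ≡⟨ cancel p q ⟩
    p                    ∎
    where
    open ≤-Reasoning
    cancel : ∀ p q → q + - - (p - q) ≡ p
    cancel = solve-∀ ℚ-ring

  ∣p∣≤r⇒-r≤p : ∀ {p r} → ∣ p ∣ ≤ r → - r ≤ p
  ∣p∣≤r⇒-r≤p {p} ∣p∣≤r = ≤-trans (neg-antimono-≤ (≤-trans (-p≤∣p∣ p) ∣p∣≤r)) (≤-reflexive (neg-involutive p))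

  p+q≤r⇒p≤r-q : ∀ {p q r} → p + q ≤ r → p ≤ r - q
  p+q≤r⇒p≤r-q {p} {q} {r} p+q≤r = ≤-trans (≤-reflexive (sym (cancel p q))) (+-monoˡ-≤ (- q) p+q≤r)
    where
    cancel : ∀ p q → p + q - q ≡ p
    cancel = solve-∀ ℚ-ring

  ∣p∣≤0⇒p≡0 : ∀ {p} → ∣ p ∣ ≤ 0ℚ → p ≡ 0ℚ
  ∣p∣≤0⇒p≡0 {p} ∣p∣≤0 = ∣p∣≡0⇒p≡0 p (≤-antisym ∣p∣≤0 (0≤∣p∣ p))

  absorb : ∀ {Λ A a} → 0ℚ ≤ Λ → a ≤ ½ → Λ ≤ A + a * Λ → Λ ≤ A + A
  absorb {Λ} {A} {a} 0≤Λ a≤½ Λ≤A+aΛ = begin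
    Λ                              ≡⟨ halves Λ ⟩
    (Λ - ½ * Λ) + (Λ - ½ * Λ)      ≤⟨ +-mono-≤ half≤A half≤A ⟩
    A + A                          ∎
    where
    open ≤-Reasoning
    halves : ∀ Λ → Λ ≡ (Λ - ½ * Λ) + (Λ - ½ * Λ)
    halves = solve-∀ ℚ-ring
    cancel : ∀ A x → A + x - x ≡ A
    cancel = solve-∀ ℚ-ring
    half≤A : Λ - ½ * Λ ≤ A
    half≤A = begin
      Λ - ½ * Λ          ≤⟨ +-monoˡ-≤ (- (½ * Λ)) (≤-trans Λ≤A+aΛ (+-monoʳ-≤ A (*-monoʳ-≤-0≤ 0≤Λ a≤½))) ⟩
      A + ½ * Λ - ½ * Λ  ≡⟨ cancel A (½ * Λ) ⟩
      A                  ∎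

  -- Finite sums
  ∑≡sum : ∀ {m} (f : Fin m → ℚ) → ∑ f ≡ sum f
  ∑≡sum {zero}  f = refl
  ∑≡sum {suc m} f = cong (f zero +_) (∑≡sum (f ∘ suc))

  sum-const : ∀ m c → ∑[ i < m ] c ≡ fromℕ m * c
  sum-const zero    c = sym (*-zeroˡ c)
  sum-const (suc m) c = begin
    c + ∑[ i < m ] c        ≡⟨ cong (c +_) (sum-const m c) ⟩
    c + fromℕ m * c         ≡⟨ distrib c (fromℕ m) ⟩
    (1ℚ + fromℕ m) * c      ≡⟨ cong (_* c) (fromℕ-homo-+ 1 m) ⟨
    fromℕ (suc m) * c       ∎
    where
    open ≡-Reasoning
    distrib : ∀ c x → c + x * c ≡ (1ℚ + x) * c
    distrib = solve-∀ ℚ-ring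

  sum-neg : ∀ {m} (f : Fin m → ℚ) → ∑[ i < m ] (- f i) ≡ - sum f
  sum-neg {zero}  f = refl
  sum-neg {suc m} f = trans (cong (- f zero +_) (sum-neg (f ∘ suc))) (sym (neg-distrib-+ (f zero) _))

  sum-sub : ∀ {m} (f g : Fin m → ℚ) → ∑[ i < m ] (f i - g i) ≡ sum f - sum g
  sum-sub f g = trans (∑-distrib-+ f (λ i → - g i)) (cong (sum f +_) (sum-neg g))

  sum-mono-≤ : ∀ {m} {f g : Fin m → ℚ} → (∀ i → f i ≤ g i) → sum f ≤ sum g
  sum-mono-≤ {zero}  f≤g = ≤-refl
  sum-mono-≤ {suc m} f≤g = +-mono-≤ (f≤g zero) (sum-mono-≤ (f≤g ∘ suc))

  sum-nonNeg : ∀ {m} {f : Fin m → ℚ} → (∀ i → 0ℚ ≤ f i) → 0ℚ ≤ sum f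
  sum-nonNeg {m} 0≤f = ≤-trans (≤-reflexive (sym (sum-replicate-zero m))) (sum-mono-≤ 0≤f)

  sum-≤-const : ∀ {m} {f : Fin m → ℚ} c → (∀ i → f i ≤ c) → sum f ≤ fromℕ m * c
  sum-≤-const {m} c f≤c = ≤-trans (sum-mono-≤ f≤c) (≤-reflexive (sum-const m c))

  ≤-sum : ∀ {m} {f : Fin m → ℚ} → (∀ i → 0ℚ ≤ f i) → ∀ i → f i ≤ sum f
  ≤-sum {suc m} {f} 0≤f zero    = ≤-trans (≤-reflexive (sym (+-identityʳ (f zero))))
                                           (+-monoʳ-≤ (f zero) (sum-nonNeg (0≤f ∘ suc)))
  ≤-sum {suc m} {f} 0≤f (suc i) = ≤-trans (≤-sum (0≤f ∘ suc) i)
                                   (≤-trans (≤-reflexive (sym (+-identityˡ _))) (+-monoˡ-≤ _ (0≤f zero)))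

  ∣sum∣≤sum∣∣ : ∀ {m} (f : Fin m → ℚ) → ∣ sum f ∣ ≤ ∑[ i < m ] ∣ f i ∣
  ∣sum∣≤sum∣∣ {zero}  f = ≤-refl
  ∣sum∣≤sum∣∣ {suc m} f = ≤-trans (∣p+q∣≤∣p∣+∣q∣ (f zero) _) (+-monoʳ-≤ ∣ f zero ∣ (∣sum∣≤sum∣∣ (f ∘ suc)))

  δ : ∀ {n} → Fin n → Fin n → ℚ
  δ zero    zero    = 1ℚ
  δ zero    (suc k) = 0ℚ
  δ (suc j) zero    = 0ℚ
  δ (suc j) (suc k) = δ j k

  δ-refl : ∀ {n} (j : Fin n) → δ j j ≡ 1ℚ
  δ-refl zero    = refl
  δ-refl (suc j) = δ-refl j

  δ-≢ : ∀ {n} {j k : Fin n} → j ≢ k → δ j k ≡ 0ℚ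
  δ-≢ {j = zero}  {zero}  j≢k = ⊥-elim (j≢k refl)
  δ-≢ {j = zero}  {suc k} j≢k = refl
  δ-≢ {j = suc j} {zero}  j≢k = refl
  δ-≢ {j = suc j} {suc k} j≢k = δ-≢ (j≢k ∘ cong suc)

  δ-sym : ∀ {n} (j k : Fin n) → δ j k ≡ δ k j
  δ-sym zero    zero    = refl
  δ-sym zero    (suc k) = refl
  δ-sym (suc j) zero    = refl
  δ-sym (suc j) (suc k) = δ-sym j k

  0≤δ : ∀ {n} (j k : Fin n) → 0ℚ ≤ δ j k
  0≤δ j k with j Fin.≟ k
  ... | yes refl = ≤-trans (fromℕ-mono-≤ z≤n) (≤-reflexive (sym (δ-refl j)))
  ... | no j≢k   = ≤-reflexive (sym (δ-≢ j≢k))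

  sum-δ : ∀ {n} (f : Fin n → ℚ) j → ∑[ k < n ] (f k * δ j k) ≡ f j
  sum-δ {suc n} f zero = begin
    f zero * 1ℚ + ∑[ k < n ] (f (suc k) * 0ℚ) ≡⟨ cong₂ _+_ (*-identityʳ (f zero)) (sum-cong-≗ (*-zeroʳ ∘ f ∘ suc)) ⟩
    f zero + ∑[ k < n ] 0ℚ                    ≡⟨ cong (f zero +_) (sum-replicate-zero n) ⟩
    f zero + 0ℚ                               ≡⟨ +-identityʳ (f zero) ⟩
    f zero                                    ∎
    where open ≡-Reasoning
  sum-δ {suc n} f (suc j) = trans (cong₂ _+_ (*-zeroʳ (f zero)) (sum-δ (f ∘ suc) j)) (+-identityˡ _)

  -- Linear and affine dependence
  LinearlyDependent : ∀ {m n} → (Fin m → Fin n → ℚ) → Set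
  LinearlyDependent {m} {n} w =
    Σ (Fin m → ℚ) λ c → (∃ λ j → c j ≢ 0ℚ) × (∀ t → ∑[ j < m ] (c j * w j t) ≡ 0ℚ)

  eliminate : ∀ {n} (w : Fin (suc (suc n)) → Fin (suc n) → ℚ) p (r : Fin (suc n) → ℚ) →
              (∀ j → w (punchIn p j) zero ≡ r j * w p zero) →
              LinearlyDependent (λ j t → w (punchIn p j) (suc t) - r j * w p (suc t)) →
              LinearlyDependent w
  eliminate {n} w p r first-reduces (c′ , (j , c′j≢0) , c′-vanishes) =
    c , (punchIn p j , λ cj≡0 → c′j≢0 (trans (sym (insertAt-punchIn c′ p cₚ j)) cj≡0)) , vanishes
    where
    cₚ = ∑[ j < suc n ] (- (c′ j * r j))
    c = insertAt c′ p cₚ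
    reduce : ∀ t → ∑[ j < suc (suc n) ] (c j * w j t) ≡ ∑[ j < suc n ] (c′ j * (w (punchIn p j) t - r j * w p t))
    reduce t = begin
      ∑[ j < suc (suc n) ] (c j * w j t)
        ≡⟨ sum-remove {i = p} (λ j → c j * w j t) ⟩
      c p * w p t + ∑[ j < suc n ] (c (punchIn p j) * w (punchIn p j) t)
        ≡⟨ cong₂ (λ a b → a * w p t + b) (insertAt-lookup c′ p cₚ)
                 (sum-cong-≗ (λ j → cong (_* w (punchIn p j) t) (insertAt-punchIn c′ p cₚ j))) ⟩
      cₚ * w p t + ∑[ j < suc n ] (c′ j * w (punchIn p j) t)
        ≡⟨ cong (_+ ∑[ j < suc n ] (c′ j * w (punchIn p j) t)) (*-distribʳ-sum (w p t) (λ j → - (c′ j * r j))) ⟩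
      ∑[ j < suc n ] (- (c′ j * r j) * w p t) + ∑[ j < suc n ] (c′ j * w (punchIn p j) t)
        ≡⟨ ∑-distrib-+ (λ j → - (c′ j * r j) * w p t) (λ j → c′ j * w (punchIn p j) t) ⟨
      ∑[ j < suc n ] (- (c′ j * r j) * w p t + c′ j * w (punchIn p j) t)
        ≡⟨ sum-cong-≗ (λ j → regroup (c′ j) (r j) (w p t) (w (punchIn p j) t)) ⟩
      ∑[ j < suc n ] (c′ j * (w (punchIn p j) t - r j * w p t)) ∎
      where
      open ≡-Reasoning
      regroup : ∀ x y b a → - (x * y) * b + x * a ≡ x * (a - y * b)
      regroup = solve-∀ ℚ-ring
    vanishes : ∀ t → ∑[ j < suc (suc n) ] (c j * w j t) ≡ 0ℚ
    vanishes zero = begin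
      ∑[ j < suc (suc n) ] (c j * w j zero)                              ≡⟨ reduce zero ⟩
      ∑[ j < suc n ] (c′ j * (w (punchIn p j) zero - r j * w p zero))
        ≡⟨ sum-cong-≗ (λ j → cong (λ a → c′ j * (a - r j * w p zero)) (first-reduces j)) ⟩
      ∑[ j < suc n ] (c′ j * (r j * w p zero - r j * w p zero))          ≡⟨ sum-cong-≗ (λ j → cancel (c′ j) (r j * w p zero)) ⟩
      ∑[ j < suc n ] 0ℚ                                                  ≡⟨ sum-replicate-zero (suc n) ⟩
      0ℚ                                                                 ∎
      where
      open ≡-Reasoning
      cancel : ∀ x a → x * (a - a) ≡ 0ℚ
      cancel = solve-∀ ℚ-ring
    vanishes (suc t) = trans (reduce (suc t)) (c′-vanishes t)

  linearlyDependent : ∀ n (w : Fin (suc n) → Fin n → ℚ) → LinearlyDependent w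
  linearlyDependent zero    w = (λ _ → 1ℚ) , (zero , λ ()) , λ ()
  linearlyDependent (suc n) w with any? (λ p → ¬? (w p zero ≟ 0ℚ))
  ... | yes (p , wp≢0) = eliminate w p r (λ j → sym (pivot (w (punchIn p j) zero) (w p zero)))
                           (linearlyDependent n (λ j t → w (punchIn p j) (suc t) - r j * w p (suc t)))
    where
    instance
      wp-nonZero : NonZero (w p zero)
      wp-nonZero = ≢-nonZero wp≢0
    r : Fin (suc n) → ℚ
    r j = w (punchIn p j) zero * 1/ (w p zero)
    pivot : ∀ a b .{{_ : NonZero b}} → a * 1/ b * b ≡ a
    pivot a b = trans (*-assoc a (1/ b) b) (trans (cong (a *_) (*-inverseˡ b)) (*-identityʳ a))
  ... | no no-pivot = eliminate w zero (λ _ → 0ℚ) (λ j → trans (first-zero (suc j)) (sym (*-zeroˡ (w zero zero))))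
                        (linearlyDependent n (λ j t → w (suc j) (suc t) - 0ℚ * w zero (suc t)))
    where
    first-zero : ∀ p → w p zero ≡ 0ℚ
    first-zero p with w p zero ≟ 0ℚ
    ... | yes wp≡0 = wp≡0
    ... | no  wp≢0 = ⊥-elim (no-pivot (p , wp≢0))

  _∈Aff_ : ∀ {d m} → Point d → (Fin m → Point d) → Set
  _∈Aff_ {d} {m} q y = Σ (Fin m → ℚ) λ λs → (sum λs ≡ 1ℚ) × (∀ t → ∑[ j < m ] (λs j * y j t) ≡ q t)

  AffinelyDependent : ∀ {d m} → (Fin m → Point d) → Set
  AffinelyDependent {d} {m} y =
    Σ (Fin m → ℚ) λ c → (∃ λ j → c j ≢ 0ℚ) × (sum c ≡ 0ℚ) × (∀ t → ∑[ j < m ] (c j * y j t) ≡ 0ℚ)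

  homogenize : ∀ {m d} → (Fin m → Point d) → Fin m → Fin (suc d) → ℚ
  homogenize y j zero    = 1ℚ
  homogenize y j (suc t) = y j t

  dependency-weights : ∀ {d m} {q : Point d} {y : Fin m → Point d} (C : Fin (suc m) → ℚ) →
                   (∀ t → ∑[ j < suc m ] (C j * homogenize (q ◂ y) j t) ≡ 0ℚ) → sum (C ∘ suc) ≡ - C zero
  dependency-weights {m = m} C vanishes = inverseʳ-unique (C zero) (sum (C ∘ suc)) (begin
    C zero + sum (C ∘ suc)                                ≡⟨ cong₂ _+_ (*-identityʳ (C zero)) (sum-cong-≗ (*-identityʳ ∘ C ∘ suc)) ⟨
    C zero * 1ℚ + ∑[ j < m ] (C (suc j) * 1ℚ)              ≡⟨ vanishes zero ⟩
    0ℚ                                                    ∎)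
    where open ≡-Reasoning

  dependency-combination : ∀ {d m} {q : Point d} {y : Fin m → Point d} (C : Fin (suc m) → ℚ) →
                 (∀ t → ∑[ j < suc m ] (C j * homogenize (q ◂ y) j t) ≡ 0ℚ) →
                 ∀ t → ∑[ j < m ] (C (suc j) * y j t) ≡ - (C zero * q t)
  dependency-combination C vanishes t = inverseʳ-unique _ _ (vanishes (suc t))

  ∈Aff⊎affinelyDependent : ∀ {d} (y : Fin (suc d) → Point d) q → q ∈Aff y ⊎ AffinelyDependent y
  ∈Aff⊎affinelyDependent {d} y q with linearlyDependent (suc d) (homogenize (q ◂ y))
  ... | C , (j , Cj≢0) , vanishes with C zero ≟ 0ℚ
  ...   | yes C₀≡0 = inj₂ (C ∘ suc , nonzero j Cj≢0 , ∑C≡0 , ∑Cy≡0)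
    where
    nonzero : ∀ j → C j ≢ 0ℚ → ∃ λ j′ → C (suc j′) ≢ 0ℚ
    nonzero zero    C₀≢0 = ⊥-elim (C₀≢0 C₀≡0)
    nonzero (suc j) Cj≢0 = j , Cj≢0
    ∑C≡0 : sum (C ∘ suc) ≡ 0ℚ
    ∑C≡0 = trans (dependency-weights C vanishes) (cong -_ C₀≡0)
    ∑Cy≡0 : ∀ t → ∑[ j < suc d ] (C (suc j) * y j t) ≡ 0ℚ
    ∑Cy≡0 t = trans (dependency-combination C vanishes t) (trans (cong (λ c → - (c * q t)) C₀≡0) (cong -_ (*-zeroˡ (q t))))
  ...   | no C₀≢0 = inj₁ (λs , ∑λ≡1 , ∑λy≡q)
    where
    instance
      C₀-nonZero : NonZero (C zero)
      C₀-nonZero = ≢-nonZero C₀≢0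
    κ = - 1/ C zero
    λs : Fin (suc d) → ℚ
    λs j = C (suc j) * κ
    ∑λ≡1 : sum λs ≡ 1ℚ
    ∑λ≡1 = begin
      ∑[ j < suc d ] (C (suc j) * κ)  ≡⟨ *-distribʳ-sum κ (C ∘ suc) ⟨
      sum (C ∘ suc) * κ              ≡⟨ cong (_* κ) (dependency-weights C vanishes) ⟩
      - C zero * - 1/ C zero         ≡⟨ neg*neg (C zero) (1/ C zero) ⟩
      C zero * 1/ C zero             ≡⟨ *-inverseʳ (C zero) ⟩
      1ℚ                             ∎
      where
      open ≡-Reasoning
      neg*neg : ∀ a b → - a * - b ≡ a * b
      neg*neg = solve-∀ ℚ-ring
    ∑λy≡q : ∀ t → ∑[ j < suc d ] (λs j * y j t) ≡ q t
    ∑λy≡q t = begin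
      ∑[ j < suc d ] (C (suc j) * κ * y j t)   ≡⟨ sum-cong-≗ (λ j → swap (C (suc j)) κ (y j t)) ⟩
      ∑[ j < suc d ] (κ * (C (suc j) * y j t)) ≡⟨ *-distribˡ-sum κ (λ j → C (suc j) * y j t) ⟨
      κ * ∑[ j < suc d ] (C (suc j) * y j t)   ≡⟨ cong (κ *_) (dependency-combination C vanishes t) ⟩
      - 1/ C zero * - (C zero * q t)           ≡⟨ cancel (1/ C zero) (C zero) (q t) ⟩
      (1/ C zero * C zero) * q t               ≡⟨ cong (_* q t) (*-inverseˡ (C zero)) ⟩
      1ℚ * q t                                 ≡⟨ *-identityˡ (q t) ⟩
      q t                                      ∎
      where
      open ≡-Reasoning
      swap : ∀ c k y → c * k * y ≡ k * (c * y)
      swap = solve-∀ ℚ-ring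
      cancel : ∀ i c q → - i * - (c * q) ≡ (i * c) * q
      cancel = solve-∀ ℚ-ring

  flat-affinelyDependent : ∀ {d k} (a : Point d) (v : Fin k → Point d) (p : Fin (suc (suc k)) → Point d) →
                           (∀ j → InFlat a v (p j)) → AffinelyDependent p
  flat-affinelyDependent {d} {k} a v p p∈flat = C , nonzero , ∑C≡0 , ∑Cp≡0
    where
    μ : Fin (suc (suc k)) → Point k
    μ = proj₁ ∘ p∈flat
    dependency = linearlyDependent (suc k) (homogenize μ)
    C = proj₁ dependency
    nonzero = proj₁ (proj₂ dependency)
    vanishes = proj₂ (proj₂ dependency)
    ∑C≡0 : sum C ≡ 0ℚ
    ∑C≡0 = trans (sum-cong-≗ (sym ∘ *-identityʳ ∘ C)) (vanishes zero)
    ∑Cμv≡0 : ∀ t l → ∑[ j < suc (suc k) ] (C j * (μ j l * v l t)) ≡ 0ℚ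
    ∑Cμv≡0 t l = begin
      ∑[ j < suc (suc k) ] (C j * (μ j l * v l t)) ≡⟨ sum-cong-≗ (λ j → *-assoc (C j) (μ j l) (v l t)) ⟨
      ∑[ j < suc (suc k) ] (C j * μ j l * v l t)   ≡⟨ *-distribʳ-sum (v l t) (λ j → C j * μ j l) ⟨
      ∑[ j < suc (suc k) ] (C j * μ j l) * v l t   ≡⟨ cong (_* v l t) (vanishes (suc l)) ⟩
      0ℚ * v l t                                   ≡⟨ *-zeroˡ (v l t) ⟩
      0ℚ                                           ∎
      where open ≡-Reasoning
    ∑Cp≡0 : ∀ t → ∑[ j < suc (suc k) ] (C j * p j t) ≡ 0ℚ
    ∑Cp≡0 t = begin
      ∑[ j < suc (suc k) ] (C j * p j t)
        ≡⟨ sum-cong-≗ (λ j → cong (C j *_) (trans (proj₂ (p∈flat j) t) (cong (a t +_) (∑≡sum (λ l → μ j l * v l t))))) ⟩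
      ∑[ j < suc (suc k) ] (C j * (a t + ∑[ l < k ] (μ j l * v l t)))
        ≡⟨ sum-cong-≗ (λ j → trans (*-distribˡ-+ (C j) (a t) _) (cong (C j * a t +_) (*-distribˡ-sum (C j) (λ l → μ j l * v l t)))) ⟩
      ∑[ j < suc (suc k) ] (C j * a t + ∑[ l < k ] (C j * (μ j l * v l t)))
        ≡⟨ ∑-distrib-+ (λ j → C j * a t) (λ j → ∑[ l < k ] (C j * (μ j l * v l t))) ⟩
      ∑[ j < suc (suc k) ] (C j * a t) + ∑[ j < suc (suc k) ] ∑[ l < k ] (C j * (μ j l * v l t))
        ≡⟨ cong₂ _+_ (sym (*-distribʳ-sum (a t) C)) (∑-comm (λ j l → C j * (μ j l * v l t))) ⟩
      sum C * a t + ∑[ l < k ] ∑[ j < suc (suc k) ] (C j * (μ j l * v l t))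
        ≡⟨ cong₂ _+_ (cong (_* a t) ∑C≡0) (sum-cong-≗ (∑Cμv≡0 t)) ⟩
      0ℚ * a t + ∑[ l < k ] 0ℚ
        ≡⟨ cong₂ _+_ (*-zeroˡ (a t)) (sum-replicate-zero k) ⟩
      0ℚ + 0ℚ
        ≡⟨ +-identityʳ 0ℚ ⟩
      0ℚ ∎
      where open ≡-Reasoning

  -- Affine forms and perturbed simplices
  record AffineForm (m : ℕ) : Set where
    constructor affineForm
    field
      const : ℚ
      coeff : Fin m → ℚ

    linear : (Fin m → ℚ) → ℚ
    linear X = ∑[ k < m ] (coeff k * X k)

    _⟪_⟫ : (Fin m → ℚ) → ℚ
    _⟪_⟫ X = const + linear X

    ‖_‖ : ℚ
    ‖_‖ = ∑[ k < m ] ∣ coeff k ∣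
  open AffineForm public

  ⟪⟫-lipschitz : ∀ {m} (f : AffineForm m) {X Y} {η} → (∀ k → ∣ X k - Y k ∣ ≤ η) →
                 ∣ f ⟪ X ⟫ - f ⟪ Y ⟫ ∣ ≤ ‖ f ‖ * η
  ⟪⟫-lipschitz {m} f {X} {Y} {η} X≈Y = begin
    ∣ f ⟪ X ⟫ - f ⟪ Y ⟫ ∣                          ≡⟨ cong ∣_∣ (difference (const f) (linear f X) (linear f Y)) ⟩
    ∣ linear f X - linear f Y ∣                    ≡⟨ cong ∣_∣ (sum-sub (λ k → coeff f k * X k) (λ k → coeff f k * Y k)) ⟨
    ∣ ∑[ k < m ] (coeff f k * X k - coeff f k * Y k) ∣ ≤⟨ ∣sum∣≤sum∣∣ (λ k → coeff f k * X k - coeff f k * Y k) ⟩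
    ∑[ k < m ] ∣ coeff f k * X k - coeff f k * Y k ∣ ≡⟨ sum-cong-≗ (λ k → trans (cong ∣_∣ (factor (coeff f k) (X k) (Y k)))
                                                                            (∣p*q∣≡∣p∣*∣q∣ (coeff f k) (X k - Y k))) ⟩
    ∑[ k < m ] (∣ coeff f k ∣ * ∣ X k - Y k ∣)       ≤⟨ sum-mono-≤ (λ k → *-monoˡ-≤-0≤ (0≤∣p∣ (coeff f k)) (X≈Y k)) ⟩
    ∑[ k < m ] (∣ coeff f k ∣ * η)                  ≡⟨ *-distribʳ-sum η (λ k → ∣ coeff f k ∣) ⟨
    ‖ f ‖ * η                                      ∎
    where
    open ≤-Reasoning
    difference : ∀ c a b → (c + a) - (c + b) ≡ a - b
    difference = solve-∀ ℚ-ring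
    factor : ∀ c x y → c * x - c * y ≡ c * (x - y)
    factor = solve-∀ ℚ-ring

  linear-combination : ∀ {m} (f : AffineForm m) a b X Y →
                       linear f (λ k → a * X k + b * Y k) ≡ a * linear f X + b * linear f Y
  linear-combination {m} f a b X Y = begin
    ∑[ k < m ] (coeff f k * (a * X k + b * Y k))
      ≡⟨ sum-cong-≗ (λ k → distrib (coeff f k) a b (X k) (Y k)) ⟩
    ∑[ k < m ] (a * (coeff f k * X k) + b * (coeff f k * Y k))
      ≡⟨ ∑-distrib-+ (λ k → a * (coeff f k * X k)) (λ k → b * (coeff f k * Y k)) ⟩
    ∑[ k < m ] (a * (coeff f k * X k)) + ∑[ k < m ] (b * (coeff f k * Y k))
      ≡⟨ cong₂ _+_ (sym (*-distribˡ-sum a (λ k → coeff f k * X k))) (sym (*-distribˡ-sum b (λ k → coeff f k * Y k))) ⟩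
    a * linear f X + b * linear f Y ∎
    where
    open ≡-Reasoning
    distrib : ∀ c a b x y → c * (a * x + b * y) ≡ a * (c * x) + b * (c * y)
    distrib = solve-∀ ℚ-ring

  ⟪⟫-combination : ∀ {m p} (f : AffineForm m) (g : Fin p → ℚ) (Z : Fin p → Fin m → ℚ) {Q} →
                   (∀ k → ∑[ j < p ] (g j * Z j k) ≡ Q k) →
                   ∑[ j < p ] (g j * f ⟪ Z j ⟫) ≡ sum g * const f + linear f Q
  ⟪⟫-combination {m} {p} f g Z {Q} ∑gZ≡Q = begin
    ∑[ j < p ] (g j * f ⟪ Z j ⟫)
      ≡⟨ sum-cong-≗ (λ j → trans (*-distribˡ-+ (g j) (const f) (linear f (Z j))) (cong (g j * const f +_) (*-distribˡ-sum (g j) (λ k → coeff f k * Z j k)))) ⟩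
    ∑[ j < p ] (g j * const f + ∑[ k < m ] (g j * (coeff f k * Z j k)))
      ≡⟨ ∑-distrib-+ (λ j → g j * const f) _ ⟩
    ∑[ j < p ] (g j * const f) + ∑[ j < p ] ∑[ k < m ] (g j * (coeff f k * Z j k))
      ≡⟨ cong₂ _+_ (sym (*-distribʳ-sum (const f) g)) (∑-comm (λ j k → g j * (coeff f k * Z j k))) ⟩
    sum g * const f + ∑[ k < m ] ∑[ j < p ] (g j * (coeff f k * Z j k))
      ≡⟨ cong (sum g * const f +_) (sum-cong-≗ λ k → trans (sum-cong-≗ (λ j → swap (g j) (coeff f k) (Z j k)))
                                                            (sym (*-distribˡ-sum (coeff f k) (λ j → g j * Z j k)))) ⟩
    sum g * const f + ∑[ k < m ] (coeff f k * ∑[ j < p ] (g j * Z j k))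
      ≡⟨ cong (sum g * const f +_) (sum-cong-≗ (λ k → cong (coeff f k *_) (∑gZ≡Q k))) ⟩
    sum g * const f + linear f Q ∎
    where
    open ≡-Reasoning
    swap : ∀ g c z → g * (c * z) ≡ c * (g * z)
    swap = solve-∀ ℚ-ring

  ⟪⟫-at-0 : ∀ {m} (f : AffineForm m) {X} → (∀ k → X k ≡ 0ℚ) → f ⟪ X ⟫ ≡ const f
  ⟪⟫-at-0 {m} f {X} X≡0 = begin
    const f + ∑[ k < m ] (coeff f k * X k)
      ≡⟨ cong (const f +_) (sum-cong-≗ (λ k → trans (cong (coeff f k *_) (X≡0 k)) (*-zeroʳ (coeff f k)))) ⟩
    const f + ∑[ k < m ] 0ℚ                ≡⟨ cong (const f +_) (sum-replicate-zero m) ⟩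
    const f + 0ℚ                           ≡⟨ +-identityʳ (const f) ⟩
    const f                                ∎
    where open ≡-Reasoning

  form₂ : ∀ {m} → ℚ → ℚ → Fin m → ℚ → Fin m → AffineForm m
  form₂ c₀ c₁ a c₂ b = affineForm c₀ (λ k → c₁ * δ a k + c₂ * δ b k)

  private
    sum-δ₂ : ∀ {m} c₁ (a : Fin m) c₂ b (X : Fin m → ℚ) →
             ∑[ k < m ] ((c₁ * δ a k + c₂ * δ b k) * X k) ≡ c₁ * X a + c₂ * X b
    sum-δ₂ {m} c₁ a c₂ b X = begin
      ∑[ k < m ] ((c₁ * δ a k + c₂ * δ b k) * X k)
        ≡⟨ sum-cong-≗ (λ k → regroup c₁ c₂ (δ a k) (δ b k) (X k)) ⟩
      ∑[ k < m ] (c₁ * X k * δ a k + c₂ * X k * δ b k)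
        ≡⟨ ∑-distrib-+ (λ k → c₁ * X k * δ a k) (λ k → c₂ * X k * δ b k) ⟩
      ∑[ k < m ] (c₁ * X k * δ a k) + ∑[ k < m ] (c₂ * X k * δ b k)
        ≡⟨ cong₂ _+_ (sum-δ (λ k → c₁ * X k) a) (sum-δ (λ k → c₂ * X k) b) ⟩
      c₁ * X a + c₂ * X b ∎
      where
      open ≡-Reasoning
      regroup : ∀ c₁ c₂ x y z → (c₁ * x + c₂ * y) * z ≡ c₁ * z * x + c₂ * z * y
      regroup = solve-∀ ℚ-ring

  form₂-⟪⟫ : ∀ {m} c₀ c₁ (a : Fin m) c₂ b X → form₂ c₀ c₁ a c₂ b ⟪ X ⟫ ≡ c₀ + c₁ * X a + c₂ * X b
  form₂-⟪⟫ c₀ c₁ a c₂ b X = trans (cong (c₀ +_) (sum-δ₂ c₁ a c₂ b X)) (sym (+-assoc c₀ _ _))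

  ‖form₂‖≤ : ∀ {m} c₀ c₁ (a : Fin m) c₂ b → ‖ form₂ c₀ c₁ a c₂ b ‖ ≤ ∣ c₁ ∣ + ∣ c₂ ∣
  ‖form₂‖≤ {m} c₀ c₁ a c₂ b = begin
    ∑[ k < m ] ∣ c₁ * δ a k + c₂ * δ b k ∣               ≤⟨ sum-mono-≤ (λ k → ∣p+q∣≤∣p∣+∣q∣ (c₁ * δ a k) (c₂ * δ b k)) ⟩
    ∑[ k < m ] (∣ c₁ * δ a k ∣ + ∣ c₂ * δ b k ∣)
      ≡⟨ sum-cong-≗ (λ k → trans (cong₂ _+_ (∣cδ∣ c₁ a k) (∣cδ∣ c₂ b k)) (sym (*-identityʳ _))) ⟩
    ∑[ k < m ] ((∣ c₁ ∣ * δ a k + ∣ c₂ ∣ * δ b k) * 1ℚ)  ≡⟨ sum-δ₂ (∣ c₁ ∣) a (∣ c₂ ∣) b (λ _ → 1ℚ) ⟩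
    ∣ c₁ ∣ * 1ℚ + ∣ c₂ ∣ * 1ℚ                            ≡⟨ cong₂ _+_ (*-identityʳ ∣ c₁ ∣) (*-identityʳ ∣ c₂ ∣) ⟩
    ∣ c₁ ∣ + ∣ c₂ ∣                                      ∎
    where
    open ≤-Reasoning
    ∣cδ∣ : ∀ c a k → ∣ c * δ a k ∣ ≡ ∣ c ∣ * δ a k
    ∣cδ∣ c a k = trans (∣p*q∣≡∣p∣*∣q∣ c (δ a k)) (cong (∣ c ∣ *_) (0≤p⇒∣p∣≡p (0≤δ a k)))

  -- The affine coordinates g of a point with respect to Z differ from the values F of the forms f by at
  -- most Λ ε, where Λ is the ℓ¹-norm of g; since n ε ≤ ½ this bounds Λ by 2 n max ∣F∣.
  module Perturbation {n m} (Y Z : Fin n → Fin m → ℚ) (f : Fin n → AffineForm m) {B η : ℚ}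
    (0≤B : 0ℚ ≤ B) (0≤η : 0ℚ ≤ η) (‖f‖≤B : ∀ j → ‖ f j ‖ ≤ B)
    (biorthogonal : ∀ j k → f j ⟪ Y k ⟫ ≡ δ j k)
    (Z≈Y : ∀ k t → ∣ Z k t - Y k t ∣ ≤ η)
    (small : fromℕ n * (B * η) ≤ ½) where

    ε : ℚ
    ε = B * η

    error : Fin n → Fin n → ℚ
    error j k = f j ⟪ Z k ⟫ - δ j k

    ∣error∣≤ε : ∀ j k → ∣ error j k ∣ ≤ ε
    ∣error∣≤ε j k = begin
      ∣ f j ⟪ Z k ⟫ - δ j k ∣         ≡⟨ cong (λ y → ∣ f j ⟪ Z k ⟫ - y ∣) (biorthogonal j k) ⟨
      ∣ f j ⟪ Z k ⟫ - f j ⟪ Y k ⟫ ∣   ≤⟨ ⟪⟫-lipschitz (f j) (Z≈Y k) ⟩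
      ‖ f j ‖ * η                    ≤⟨ *-monoʳ-≤-0≤ 0≤η (‖f‖≤B j) ⟩
      ε                              ∎
      where open ≤-Reasoning

    module _ (g : Fin n → ℚ) {Q : Fin m → ℚ} (∑gZ≡Q : ∀ t → ∑[ k < n ] (g k * Z k t) ≡ Q t) where

      F : Fin n → ℚ
      F j = sum g * const (f j) + linear (f j) Q

      Λ : ℚ
      Λ = ∑[ k < n ] ∣ g k ∣

      g+error≡F : ∀ j → g j + ∑[ k < n ] (g k * error j k) ≡ F j
      g+error≡F j = begin
        g j + ∑[ k < n ] (g k * error j k)                  ≡⟨ cong (_+ ∑[ k < n ] (g k * error j k)) (sum-δ g j) ⟨
        ∑[ k < n ] (g k * δ j k) + ∑[ k < n ] (g k * error j k) ≡⟨ ∑-distrib-+ (λ k → g k * δ j k) (λ k → g k * error j k) ⟨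
        ∑[ k < n ] (g k * δ j k + g k * error j k)          ≡⟨ sum-cong-≗ (λ k → recombine (g k) (δ j k) (f j ⟪ Z k ⟫)) ⟩
        ∑[ k < n ] (g k * f j ⟪ Z k ⟫)                      ≡⟨ ⟪⟫-combination (f j) g Z ∑gZ≡Q ⟩
        F j                                                 ∎
        where
        open ≡-Reasoning
        recombine : ∀ g d z → g * d + g * (z - d) ≡ g * z
        recombine = solve-∀ ℚ-ring

      ∣g-F∣≤Λε : ∀ j → ∣ g j - F j ∣ ≤ Λ * ε
      ∣g-F∣≤Λε j = begin
        ∣ g j - F j ∣                             ≡⟨ cong (λ x → ∣ g j - x ∣) (g+error≡F j) ⟨
        ∣ g j - (g j + ∑[ k < n ] (g k * error j k)) ∣ ≡⟨ cong ∣_∣ (cancel (g j) _) ⟩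
        ∣ - ∑[ k < n ] (g k * error j k) ∣           ≡⟨ ∣-p∣≡∣p∣ _ ⟩
        ∣ ∑[ k < n ] (g k * error j k) ∣             ≤⟨ ∣sum∣≤sum∣∣ (λ k → g k * error j k) ⟩
        ∑[ k < n ] ∣ g k * error j k ∣              ≤⟨ sum-mono-≤ (λ k → ≤-trans (≤-reflexive (∣p*q∣≡∣p∣*∣q∣ (g k) (error j k)))
                                                                            (*-monoˡ-≤-0≤ (0≤∣p∣ (g k)) (∣error∣≤ε j k))) ⟩
        ∑[ k < n ] (∣ g k ∣ * ε)                    ≡⟨ *-distribʳ-sum ε (λ k → ∣ g k ∣) ⟨
        Λ * ε                                     ∎
        where
        open ≤-Reasoning
        cancel : ∀ x s → x - (x + s) ≡ - s
        cancel = solve-∀ ℚ-ring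

      Λ≤2nM : ∀ {M} → (∀ j → ∣ F j ∣ ≤ M) → Λ ≤ fromℕ n * M + fromℕ n * M
      Λ≤2nM {M} ∣F∣≤M = absorb {Λ} {fromℕ n * M} {fromℕ n * ε} (sum-nonNeg (0≤∣p∣ ∘ g)) small (begin
        Λ                                      ≤⟨ sum-≤-const (M + Λ * ε) ∣g∣≤ ⟩
        fromℕ n * (M + Λ * ε)                  ≡⟨ distrib (fromℕ n) M Λ ε ⟩
        fromℕ n * M + fromℕ n * ε * Λ          ∎)
        where
        open ≤-Reasoning
        distrib : ∀ n M Λ ε → n * (M + Λ * ε) ≡ n * M + n * ε * Λ
        distrib = solve-∀ ℚ-ring
        split : ∀ g F → g ≡ F + (g - F)
        split = solve-∀ ℚ-ring
        ∣g∣≤ : ∀ j → ∣ g j ∣ ≤ M + Λ * ε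
        ∣g∣≤ j = begin
          ∣ g j ∣                     ≡⟨ cong ∣_∣ (split (g j) (F j)) ⟩
          ∣ F j + (g j - F j) ∣       ≤⟨ ∣p+q∣≤∣p∣+∣q∣ (F j) (g j - F j) ⟩
          ∣ F j ∣ + ∣ g j - F j ∣     ≤⟨ +-mono-≤ (∣F∣≤M j) (∣g-F∣≤Λε j) ⟩
          M + Λ * ε                   ∎

      coefficients-near-values : ∀ {M} → (∀ j → ∣ F j ∣ ≤ M) →
                                 ∀ j → ∣ g j - F j ∣ ≤ (fromℕ n * M + fromℕ n * M) * ε
      coefficients-near-values ∣F∣≤M j =
        ≤-trans (∣g-F∣≤Λε j) (*-monoʳ-≤-0≤ (0≤* 0≤B 0≤η) (Λ≤2nM ∣F∣≤M))

    affinelyIndependent : ∀ c → sum c ≡ 0ℚ → (∀ t → ∑[ k < n ] (c k * Z k t) ≡ 0ℚ) → ∀ j → c j ≡ 0ℚ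
    affinelyIndependent c ∑c≡0 ∑cZ≡0 j = ∣p∣≤0⇒p≡0 (begin
      ∣ c j ∣                           ≡⟨ cong ∣_∣ (+-identityʳ (c j)) ⟨
      ∣ c j - 0ℚ ∣                      ≡⟨ cong (λ x → ∣ c j - x ∣) (F≡0 j) ⟨
      ∣ c j - F c ∑cZ≡0 j ∣             ≤⟨ coefficients-near-values c ∑cZ≡0 (λ j → ≤-reflexive (cong ∣_∣ (F≡0 j))) j ⟩
      (fromℕ n * 0ℚ + fromℕ n * 0ℚ) * ε ≡⟨ vanish (fromℕ n) ε ⟩
      0ℚ                                ∎)
      where
      open ≤-Reasoning
      vanish : ∀ n ε → (n * 0ℚ + n * 0ℚ) * ε ≡ 0ℚ
      vanish = solve-∀ ℚ-ring
      F≡0 : ∀ j → F c ∑cZ≡0 j ≡ 0ℚ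
      F≡0 j = begin-equality
        sum c * const (f j) + linear (f j) (λ _ → 0ℚ) ≡⟨ cong₂ _+_ (cong (_* const (f j)) ∑c≡0) (sum-cong-≗ (*-zeroʳ ∘ coeff (f j))) ⟩
        0ℚ * const (f j) + ∑[ k < m ] 0ℚ            ≡⟨ cong₂ _+_ (*-zeroˡ (const (f j))) (sum-replicate-zero m) ⟩
        0ℚ + 0ℚ                                     ≡⟨ +-identityʳ 0ℚ ⟩
        0ℚ                                          ∎

    coefficient-nonNeg : ∀ λs {Q} → sum λs ≡ 1ℚ → (∀ t → ∑[ k < n ] (λs k * Z k t) ≡ Q t) →
                         ∀ {M} → (∀ j → ∣ f j ⟪ Q ⟫ ∣ ≤ M) →
                         (∀ j → (fromℕ n * M + fromℕ n * M) * ε ≤ f j ⟪ Q ⟫) → ∀ j → 0ℚ ≤ λs j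
    coefficient-nonNeg λs ∑λ≡1 ∑λZ≡Q {M} ∣fQ∣≤M margin j = begin
      0ℚ                       ≡⟨ +-inverseʳ D ⟨
      D - D                    ≤⟨ +-monoˡ-≤ (- D) (≤-trans (margin j) (≤-reflexive (sym (F≡fQ j)))) ⟩
      F λs ∑λZ≡Q j - D
        ≤⟨ ∣p-q∣≤r⇒q-r≤p (coefficients-near-values λs ∑λZ≡Q (λ j → ≤-trans (≤-reflexive (cong ∣_∣ (F≡fQ j))) (∣fQ∣≤M j)) j) ⟩
      λs j                     ∎
      where
      open ≤-Reasoning
      D = (fromℕ n * M + fromℕ n * M) * ε
      F≡fQ : ∀ j → F λs ∑λZ≡Q j ≡ f j ⟪ _ ⟫
      F≡fQ j = cong (_+ linear (f j) _) (trans (cong (_* const (f j)) ∑λ≡1) (*-identityˡ (const (f j))))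

  -- ℚ^d is identified with the hyperplane Σ y = 0 of ℚ^(d+1) by forgetting the first coordinate.
  lift : ∀ {d} → Point d → Fin (suc d) → ℚ
  lift y zero    = - sum y
  lift y (suc t) = y t

  lift-0 : ∀ {d} k → lift {d} (λ _ → 0ℚ) k ≡ 0ℚ
  lift-0 {d} zero = cong -_ (sum-replicate-zero d)
  lift-0 (suc t)  = refl

  lift-combination : ∀ {d m} (g : Fin m → ℚ) (y : Fin m → Point d) {Q} →
                     (∀ t → ∑[ j < m ] (g j * y j t) ≡ Q t) → ∀ k → ∑[ j < m ] (g j * lift (y j) k) ≡ lift Q k
  lift-combination {d} {m} g y {Q} ∑gy≡Q zero = begin
    ∑[ j < m ] (g j * - sum (y j))            ≡⟨ sum-cong-≗ (λ j → trans (sym (neg-distribʳ-* (g j) (sum (y j))))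
                                                                     (cong -_ (*-distribˡ-sum (g j) (y j)))) ⟩
    ∑[ j < m ] (- ∑[ t < d ] (g j * y j t))   ≡⟨ sum-neg (λ j → ∑[ t < d ] (g j * y j t)) ⟩
    - ∑[ j < m ] ∑[ t < d ] (g j * y j t)     ≡⟨ cong -_ (∑-comm (λ j t → g j * y j t)) ⟩
    - ∑[ t < d ] ∑[ j < m ] (g j * y j t)     ≡⟨ cong -_ (sum-cong-≗ ∑gy≡Q) ⟩
    - sum Q                                   ∎
    where open ≡-Reasoning
  lift-combination g y ∑gy≡Q (suc t) = ∑gy≡Q t

  perturbed-simplex-contains :
    ∀ {d} (y : Fin (suc d) → Point d) (Ideal : Fin (suc d) → Fin (suc d) → ℚ) (f : Fin (suc d) → AffineForm (suc d))
    {B η M : ℚ} → 0ℚ ≤ B → 0ℚ ≤ η → (∀ j → ‖ f j ‖ ≤ B) → (∀ j k → f j ⟪ Ideal k ⟫ ≡ δ j k) →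
    (∀ k t → ∣ lift (y k) t - Ideal k t ∣ ≤ η) → fromℕ (suc d) * (B * η) ≤ ½ →
    ∀ Q → (∀ j → ∣ f j ⟪ lift Q ⟫ ∣ ≤ M) → (∀ j → (fromℕ (suc d) * M + fromℕ (suc d) * M) * (B * η) ≤ f j ⟪ lift Q ⟫) →
    Q ∈Conv y
  perturbed-simplex-contains {d} y Ideal f 0≤B 0≤η ‖f‖≤B biorthogonal y≈Ideal small Q ∣fQ∣≤M margin
    with ∈Aff⊎affinelyDependent y Q
  ... | inj₁ (λs , ∑λ≡1 , ∑λy≡Q) =
    λs , coefficient-nonNeg λs ∑λ≡1 (lift-combination λs y ∑λy≡Q) ∣fQ∣≤M margin ,
    trans (∑≡sum λs) ∑λ≡1 , λ t → trans (∑≡sum (λ j → λs j * y j t)) (∑λy≡Q t)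
    where open Perturbation Ideal (lift ∘ y) f 0≤B 0≤η ‖f‖≤B biorthogonal y≈Ideal small
  ... | inj₂ (c , (j , cj≢0) , ∑c≡0 , ∑cy≡0) =
    ⊥-elim (cj≢0 (affinelyIndependent c ∑c≡0 (λ k → trans (lift-combination c y ∑cy≡0 k) (lift-0 k)) j))
    where open Perturbation Ideal (lift ∘ y) f 0≤B 0≤η ‖f‖≤B biorthogonal y≈Ideal small

  -- General position
  module ℤΣ = Sum ℤ.+-*-semiring

  ∣-sum : ∀ {m} {k : ℤ} {f : Fin m → ℤ} → (∀ j → k ∣ f j) → k ∣ ℤΣ.sum f
  ∣-sum {zero}  {k} k∣f = divides ℤ.0ℤ (sym (ℤ.*-zeroˡ k))
  ∣-sum {suc m} k∣f = ∣m∣n⇒∣m+n (k∣f zero) (∣-sum (k∣f ∘ suc))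

  vandermonde-divisibility : ∀ (k : ℤ) n (c ν : Fin (suc n) → ℤ) →
    (∀ i j → i ≢ j → Coprime k (ν i ℤ.- ν j)) →
    (∀ e → e ℕ.≤ n → k ∣ ℤΣ.sum (λ j → c j ℤ.* ν j ℤ.^ e)) → ∀ j → k ∣ c j
  vandermonde-divisibility k zero c ν coprime k∣powerSum zero =
    subst (k ∣_) (trans (ℤ.+-identityʳ _) (ℤ.*-identityʳ (c zero))) (k∣powerSum 0 z≤n)
  vandermonde-divisibility k (suc n) c ν coprime k∣powerSum = k∣c
    where
    c′ : Fin (suc n) → ℤ
    c′ j = c (suc j) ℤ.* (ν (suc j) ℤ.- ν zero)
    shift : ∀ e → ℤΣ.sum (λ j → c j ℤ.* ν j ℤ.^ suc e) ℤ.+ ℤ.- ν zero ℤ.* ℤΣ.sum (λ j → c j ℤ.* ν j ℤ.^ e)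
                  ≡ ℤΣ.sum (λ j → c′ j ℤ.* ν (suc j) ℤ.^ e)
    shift e = begin
      ℤΣ.sum (λ j → c j ℤ.* ν j ℤ.^ suc e) ℤ.+ ℤ.- ν zero ℤ.* ℤΣ.sum (λ j → c j ℤ.* ν j ℤ.^ e)
        ≡⟨ cong (λ x → ℤΣ.sum (λ j → c j ℤ.* ν j ℤ.^ suc e) ℤ.+ x) (ℤΣ.*-distribˡ-sum (ℤ.- ν zero) (λ j → c j ℤ.* ν j ℤ.^ e)) ⟩
      ℤΣ.sum (λ j → c j ℤ.* ν j ℤ.^ suc e) ℤ.+ ℤΣ.sum (λ j → ℤ.- ν zero ℤ.* (c j ℤ.* ν j ℤ.^ e))
        ≡⟨ ℤΣ.∑-distrib-+ (λ j → c j ℤ.* ν j ℤ.^ suc e) (λ j → ℤ.- ν zero ℤ.* (c j ℤ.* ν j ℤ.^ e)) ⟨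
      ℤΣ.sum (λ j → c j ℤ.* ν j ℤ.^ suc e ℤ.+ ℤ.- ν zero ℤ.* (c j ℤ.* ν j ℤ.^ e))
        ≡⟨ ℤΣ.sum-cong-≗ (λ j → factor (c j) (ν j) (ν zero) (ν j ℤ.^ e)) ⟩
      c zero ℤ.* (ν zero ℤ.- ν zero) ℤ.* ν zero ℤ.^ e ℤ.+ ℤΣ.sum (λ j → c′ j ℤ.* ν (suc j) ℤ.^ e)
        ≡⟨ cong (λ x → x ℤ.+ ℤΣ.sum (λ j → c′ j ℤ.* ν (suc j) ℤ.^ e)) (vanish (c zero) (ν zero) (ν zero ℤ.^ e)) ⟩
      ℤ.0ℤ ℤ.+ ℤΣ.sum (λ j → c′ j ℤ.* ν (suc j) ℤ.^ e)
        ≡⟨ ℤ.+-identityˡ _ ⟩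
      ℤΣ.sum (λ j → c′ j ℤ.* ν (suc j) ℤ.^ e) ∎
      where
      open ≡-Reasoning
      factor : ∀ c ν ν₀ p → c ℤ.* (ν ℤ.* p) ℤ.+ ℤ.- ν₀ ℤ.* (c ℤ.* p) ≡ c ℤ.* (ν ℤ.- ν₀) ℤ.* p
      factor = ℤ-Solver.solve-∀
      vanish : ∀ c ν p → c ℤ.* (ν ℤ.- ν) ℤ.* p ≡ ℤ.0ℤ
      vanish = ℤ-Solver.solve-∀
    k∣c′ : ∀ j → k ∣ c′ j
    k∣c′ = vandermonde-divisibility k n c′ (ν ∘ suc) (λ i j i≢j → coprime (suc i) (suc j) (i≢j ∘ suc-injective))
             (λ e e≤n → subst (k ∣_) (shift e)
                          (∣m∣n⇒∣m+n (k∣powerSum (suc e) (s≤s e≤n)) (∣n⇒∣m*n (ℤ.- ν zero) (k∣powerSum e (ℕ.m≤n⇒m≤1+n e≤n)))))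
    k∣c-tail : ∀ j → k ∣ c (suc j)
    k∣c-tail j = ∣ᵤ⇒∣ (coprime-divisor k (ν (suc j) ℤ.- ν zero) (c (suc j)) (coprime (suc j) zero λ ())
                        (∣⇒∣ᵤ (subst (k ∣_) (ℤ.*-comm (c (suc j)) _) (k∣c′ j))))
    k∣c : ∀ j → k ∣ c j
    k∣c (suc j) = k∣c-tail j
    k∣c zero    = subst (k ∣_) (ℤ.*-identityʳ (c zero))
                    (∣m+n∣n⇒∣m (k∣powerSum 0 z≤n) (∣-sum (λ j → ∣m⇒∣m*n (ℤ.+ 1) (k∣c-tail j))))

  descent : ∀ {m} (q : ℕ) → 2 ℕ.≤ q → (P : (Fin m → ℤ) → Set) →
            (∀ {c} → P c → Σ (Fin m → ℤ) λ c′ → P c′ × (∀ j → c j ≡ c′ j ℤ.* ℤ.+ q)) →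
            ∀ {c} → P c → ∀ j → c j ≡ ℤ.0ℤ
  descent {m} q 2≤q P divide {c} Pc j = go ℤ.∣ c j ∣ ℕ.≤-refl Pc
    where
    go : ∀ B {c} → ℤ.∣ c j ∣ ℕ.≤ B → P c → c j ≡ ℤ.0ℤ
    go zero    ∣cj∣≤0 _ = ℤ.∣i∣≡0⇒i≡0 (ℕ.n≤0⇒n≡0 ∣cj∣≤0)
    go (suc B) {c} ∣cj∣≤1+B Pc with divide Pc
    ... | c′ , Pc′ , c≡c′q = trans (c≡c′q j) (trans (cong (ℤ._* ℤ.+ q) (go B ∣c′j∣≤B Pc′)) (ℤ.*-zeroˡ (ℤ.+ q)))
      where
      ∣cj∣≡∣c′j∣q : ℤ.∣ c j ∣ ≡ ℤ.∣ c′ j ∣ ℕ.* q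
      ∣cj∣≡∣c′j∣q = trans (cong ℤ.∣_∣ (c≡c′q j)) (ℤ.abs-* (c′ j) (ℤ.+ q))
      ∣c′j∣≤B : ℤ.∣ c′ j ∣ ℕ.≤ B
      ∣c′j∣≤B with ℤ.∣ c′ j ∣ in eq
      ... | zero    = z≤n
      ... | suc a = ℕ.≤-pred (ℕ.<-≤-trans (ℕ.m<m*n (suc a) q 2≤q)
                                           (ℕ.≤-trans (ℕ.≤-reflexive (sym (trans ∣cj∣≡∣c′j∣q (cong (ℕ._* q) eq)))) ∣cj∣≤1+B))

  fromℤ-homo-sum : ∀ {m} (f : Fin m → ℤ) → fromℤ (ℤΣ.sum f) ≡ ∑[ j < m ] fromℤ (f j)
  fromℤ-homo-sum {zero}  f = refl
  fromℤ-homo-sum {suc m} f = trans (fromℤ-homo-+ (f zero) _) (cong (fromℤ (f zero) +_) (fromℤ-homo-sum (f ∘ suc)))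

  r*denominator≡numerator : ∀ r → r * fromℕ (ℚ.denominatorℕ r) ≡ fromℤ (ℚ.numerator r)
  r*denominator≡numerator r@(ℚ.mkℚ a b _) =
    toℚᵘ-injective (ℚᵘ.≃-trans (toℚᵘ-homo-* r (fromℕ (suc b))) (ℚᵘ.*≡* (cross a b)))
    where
    cross : ∀ a b → (a ℤ.* ℤ.+ suc b) ℤ.* ℤ.+ 1 ≡ a ℤ.* ℤ.+ suc (b ℕ.* 1)
    cross a b = trans (ℤ.*-identityʳ _) (cong (λ x → a ℤ.* ℤ.+ suc x) (sym (ℕ.*-identityʳ b)))

  clearDenominators : ∀ {m} (C : Fin m → ℚ) →
                      Σ ℕ λ D → D ≢ 0 × Σ (Fin m → ℤ) λ c → ∀ j → C j * fromℕ D ≡ fromℤ (c j)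
  clearDenominators {zero}  C = 1 , (λ ()) , (λ ()) , (λ ())
  clearDenominators {suc m} C with clearDenominators (C ∘ suc)
  ... | D , D≢0 , c , C*D≡c = b ℕ.* D , bD≢0 , c₀ ◂ (λ j → c j ℤ.* ℤ.+ b) , cleared
    where
    b  = ℚ.denominatorℕ (C zero)
    c₀ = ℚ.numerator (C zero) ℤ.* ℤ.+ D
    bD≢0 : b ℕ.* D ≢ 0
    bD≢0 bD≡0 with ℕ.m*n≡0⇒m≡0∨n≡0 b bD≡0
    ... | inj₁ ()
    ... | inj₂ D≡0 = D≢0 D≡0
    cleared : ∀ j → C j * fromℕ (b ℕ.* D) ≡ fromℤ ((c₀ ◂ (λ j → c j ℤ.* ℤ.+ b)) j)
    cleared zero = begin
      C zero * fromℕ (b ℕ.* D)          ≡⟨ cong (C zero *_) (fromℕ-homo-* b D) ⟩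
      C zero * (fromℕ b * fromℕ D)      ≡⟨ *-assoc (C zero) (fromℕ b) (fromℕ D) ⟨
      C zero * fromℕ b * fromℕ D        ≡⟨ cong (_* fromℕ D) (r*denominator≡numerator (C zero)) ⟩
      fromℤ (ℚ.numerator (C zero)) * fromℕ D ≡⟨ fromℤ-homo-* (ℚ.numerator (C zero)) (ℤ.+ D) ⟨
      fromℤ c₀                          ∎
      where open ≡-Reasoning
    cleared (suc j) = begin
      C (suc j) * fromℕ (b ℕ.* D)       ≡⟨ cong (C (suc j) *_) (fromℕ-homo-* b D) ⟩
      C (suc j) * (fromℕ b * fromℕ D)   ≡⟨ swap (C (suc j)) (fromℕ b) (fromℕ D) ⟩
      C (suc j) * fromℕ D * fromℕ b     ≡⟨ cong (_* fromℕ b) (C*D≡c j) ⟩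
      fromℤ (c j) * fromℕ b             ≡⟨ fromℤ-homo-* (c j) (ℤ.+ b) ⟨
      fromℤ (c j ℤ.* ℤ.+ b)             ∎
      where
      open ≡-Reasoning
      swap : ∀ x y z → x * (y * z) ≡ x * z * y
      swap = solve-∀ ℚ-ring

  +-^ : ∀ (a s : ℕ) → ℤ.+ (a ℕ.^ s) ≡ (ℤ.+ a) ℤ.^ s
  +-^ a zero    = refl
  +-^ a (suc s) = trans (ℤ.pos-* a (a ℕ.^ s)) (cong (ℤ.+ a ℤ.*_) (+-^ a s))

  suc[N!*R]-coprime : ∀ N R {a b} → a ℕ.< N → b ℕ.< N → a ≢ b →
                      Coprime (ℤ.+ suc (N ! ℕ.* R)) (ℤ.+ a ℤ.- ℤ.+ b)
  suc[N!*R]-coprime N R {a} {b} a<N b<N a≢b {i} (i∣q , i∣g) =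
    ℕ.∣1⇒≡1 (ℕ.∣m+n∣m⇒∣n (subst (i ℕ.∣_) (ℕ.+-comm 1 (N ! ℕ.* R)) i∣q) (ℕ.∣m⇒∣m*n R (ℕ.∣-trans i∣g g∣N!)))
    where
    g = ℤ.∣ ℤ.+ a ℤ.- ℤ.+ b ∣
    g≢0 : g ≢ 0
    g≢0 g≡0 = a≢b (ℤ.+-injective (ℤ.i-j≡0⇒i≡j (ℤ.+ a) (ℤ.+ b) (ℤ.∣i∣≡0⇒i≡0 g≡0)))
    g≤N : g ℕ.≤ N
    g≤N = ℕ.≤-trans (subst (ℕ._≤ a ℕ.⊔ b) (cong ℤ.∣_∣ (sym (ℤ.m-n≡m⊖n a b))) (ℤ.∣m⊝n∣≤m⊔n a b))
                    (ℕ.⊔-lub (ℕ.<⇒≤ a<N) (ℕ.<⇒≤ b<N))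
    g∣N! : g ℕ.∣ N !
    g∣N! with g | g≢0 | g≤N
    ... | zero    | g≢0 | _   = ⊥-elim (g≢0 refl)
    ... | suc h   | _   | h<N = ℕ.∣-trans (ℕ.divides (h !) (ℕ.*-comm (suc h) (h !))) (ℕ.m≤n⇒m!∣n! h<N)

  -- Clearing denominators in an affine dependence of k + 2 ≤ d + 1 of the points z gives an integer
  -- dependence of the points q z ≡ (ν, ν², …, ν^d) (mod q).  As q is coprime to all node differences,
  -- the Vandermonde argument makes q divide every coefficient, so the dependence can be divided by q
  -- indefinitely, which forces it to vanish.
  module MomentCurvePerturbation {d} {I : Set} (Y : I → Fin d → ℤ) (ν : I → ℕ)
    (ν-injective : ∀ {i j} → ν i ≡ ν j → i ≡ j) (N R : ℕ) (ν<N : ∀ i → ν i ℕ.< N)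
    .{{_ : ℕ.NonZero R}} where

    q : ℕ
    q = suc (N ! ℕ.* R)

    z : I → Point d
    z i t = fromℤ (Y i t) + fromℕ (ν i ℕ.^ suc (toℕ t)) * 1/ℕ q

    ScaledDependency : ∀ {m} → (Fin m → I) → (Fin m → ℤ) → Set
    ScaledDependency {m} J c = ℤΣ.sum c ≡ ℤ.0ℤ ×
      (∀ t → ℤΣ.sum (λ j → c j ℤ.* (ℤ.+ q ℤ.* Y (J j) t ℤ.+ ℤ.+ (ν (J j) ℕ.^ suc (toℕ t)))) ≡ ℤ.0ℤ)

    private
      split : ∀ {m} (c : Fin m → ℤ) (A P : Fin m → ℤ) →
              ℤΣ.sum (λ j → c j ℤ.* (ℤ.+ q ℤ.* A j ℤ.+ P j)) ≡
              ℤ.+ q ℤ.* ℤΣ.sum (λ j → c j ℤ.* A j) ℤ.+ ℤΣ.sum (λ j → c j ℤ.* P j)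
      split c A P = begin
        ℤΣ.sum (λ j → c j ℤ.* (ℤ.+ q ℤ.* A j ℤ.+ P j))
          ≡⟨ ℤΣ.sum-cong-≗ (λ j → distrib (c j) (ℤ.+ q) (A j) (P j)) ⟩
        ℤΣ.sum (λ j → ℤ.+ q ℤ.* (c j ℤ.* A j) ℤ.+ c j ℤ.* P j)
          ≡⟨ ℤΣ.∑-distrib-+ (λ j → ℤ.+ q ℤ.* (c j ℤ.* A j)) (λ j → c j ℤ.* P j) ⟩
        ℤΣ.sum (λ j → ℤ.+ q ℤ.* (c j ℤ.* A j)) ℤ.+ ℤΣ.sum (λ j → c j ℤ.* P j)
          ≡⟨ cong (λ x → x ℤ.+ ℤΣ.sum (λ j → c j ℤ.* P j)) (ℤΣ.*-distribˡ-sum (ℤ.+ q) (λ j → c j ℤ.* A j)) ⟨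
        ℤ.+ q ℤ.* ℤΣ.sum (λ j → c j ℤ.* A j) ℤ.+ ℤΣ.sum (λ j → c j ℤ.* P j) ∎
        where
        open ≡-Reasoning
        distrib : ∀ c q a p → c ℤ.* (q ℤ.* a ℤ.+ p) ≡ q ℤ.* (c ℤ.* a) ℤ.+ c ℤ.* p
        distrib = ℤ-Solver.solve-∀

      cancel-q : ∀ {m} (c′ X : Fin m → ℤ) → ℤΣ.sum (λ j → c′ j ℤ.* ℤ.+ q ℤ.* X j) ≡ ℤ.0ℤ →
                 ℤΣ.sum (λ j → c′ j ℤ.* X j) ≡ ℤ.0ℤ
      cancel-q c′ X vanishes = ℤ.*-cancelˡ-≡ (ℤ.+ q) _ ℤ.0ℤ (begin
        ℤ.+ q ℤ.* ℤΣ.sum (λ j → c′ j ℤ.* X j)    ≡⟨ ℤΣ.*-distribˡ-sum (ℤ.+ q) (λ j → c′ j ℤ.* X j) ⟩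
        ℤΣ.sum (λ j → ℤ.+ q ℤ.* (c′ j ℤ.* X j))  ≡⟨ ℤΣ.sum-cong-≗ (λ j → swap (ℤ.+ q) (c′ j) (X j)) ⟩
        ℤΣ.sum (λ j → c′ j ℤ.* ℤ.+ q ℤ.* X j)    ≡⟨ vanishes ⟩
        ℤ.0ℤ                                     ≡⟨ ℤ.*-zeroʳ (ℤ.+ q) ⟨
        ℤ.+ q ℤ.* ℤ.0ℤ                           ∎)
        where
        open ≡-Reasoning
        swap : ∀ q c x → q ℤ.* (c ℤ.* x) ≡ c ℤ.* q ℤ.* x
        swap = ℤ-Solver.solve-∀

    q-divides-dependency : ∀ {k} → suc k ℕ.≤ d → (J : Fin (suc (suc k)) → I) → (∀ {i j} → J i ≡ J j → i ≡ j) →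
                          ∀ {c} → ScaledDependency J c → ∀ j → ℤ.+ q ∣ c j
    q-divides-dependency {k} k<d J J-injective {c} (∑c≡0 , vanishes) =
      vandermonde-divisibility (ℤ.+ q) (suc k) c (ℤ.+_ ∘ ν ∘ J)
        (λ i j i≢j → suc[N!*R]-coprime N R (ν<N (J i)) (ν<N (J j)) (i≢j ∘ J-injective ∘ ν-injective))
        power-sum-divisible
      where
      power-sum-divisible : ∀ e → e ℕ.≤ suc k → ℤ.+ q ∣ ℤΣ.sum (λ j → c j ℤ.* (ℤ.+ ν (J j)) ℤ.^ e)
      power-sum-divisible zero _ = subst (ℤ.+ q ∣_) (trans (sym ∑c≡0) (ℤΣ.sum-cong-≗ (sym ∘ ℤ.*-identityʳ ∘ c)))
                                     (divides ℤ.0ℤ refl)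
      power-sum-divisible (suc e) e<k+1 = subst (ℤ.+ q ∣_) power-sum (∣m⇒∣-m (∣m⇒∣m*n (ℤΣ.sum (λ j → c j ℤ.* Y (J j) t)) ∣-refl))
        where
        t : Fin d
        t = fromℕ< (ℕ.≤-trans e<k+1 k<d)
        power-sum : ℤ.- (ℤ.+ q ℤ.* ℤΣ.sum (λ j → c j ℤ.* Y (J j) t)) ≡ ℤΣ.sum (λ j → c j ℤ.* (ℤ.+ ν (J j)) ℤ.^ suc e)
        power-sum = begin
          ℤ.- (ℤ.+ q ℤ.* ℤΣ.sum (λ j → c j ℤ.* Y (J j) t))
            ≡⟨ ℤ-inverseʳ-unique _ _ (trans (sym (split c (λ j → Y (J j) t) (λ j → ℤ.+ (ν (J j) ℕ.^ suc (toℕ t))))) (vanishes t)) ⟨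
          ℤΣ.sum (λ j → c j ℤ.* ℤ.+ (ν (J j) ℕ.^ suc (toℕ t)))
            ≡⟨ ℤΣ.sum-cong-≗ (λ j → cong (λ s → c j ℤ.* ℤ.+ (ν (J j) ℕ.^ suc s)) (toℕ-fromℕ< (ℕ.≤-trans e<k+1 k<d))) ⟩
          ℤΣ.sum (λ j → c j ℤ.* ℤ.+ (ν (J j) ℕ.^ suc e))
            ≡⟨ ℤΣ.sum-cong-≗ (λ j → cong (c j ℤ.*_) (+-^ (ν (J j)) (suc e))) ⟩
          ℤΣ.sum (λ j → c j ℤ.* (ℤ.+ ν (J j)) ℤ.^ suc e) ∎
          where
          open ≡-Reasoning

    scaled-dependencies-vanish : ∀ {k} → suc k ℕ.≤ d → (J : Fin (suc (suc k)) → I) → (∀ {i j} → J i ≡ J j → i ≡ j) →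
                       ∀ {c} → ScaledDependency J c → ∀ j → c j ≡ ℤ.0ℤ
    scaled-dependencies-vanish k<d J J-injective = descent q (s≤s (ℕ.*-mono-≤ (ℕ.1≤n! N) (ℕ.>-nonZero⁻¹ R))) (ScaledDependency J) divide
      where
      divide : ∀ {c} → ScaledDependency J c → Σ _ λ c′ → ScaledDependency J c′ × (∀ j → c j ≡ c′ j ℤ.* ℤ.+ q)
      divide {c} (∑c≡0 , vanishes) = c′ , (∑c′≡0 , vanishes′) , c≡c′q
        where
        q∣c = q-divides-dependency k<d J J-injective (∑c≡0 , vanishes)
        c′ = λ j → _∣_.quotient (q∣c j)
        c≡c′q = λ j → _∣_.equality (q∣c j)
        ∑c′≡0 : ℤΣ.sum c′ ≡ ℤ.0ℤ
        ∑c′≡0 = trans (ℤΣ.sum-cong-≗ (sym ∘ ℤ.*-identityʳ ∘ c′)) (cancel-q c′ (λ _ → ℤ.1ℤ)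
                  (trans (ℤΣ.sum-cong-≗ (λ j → trans (ℤ.*-identityʳ _) (sym (c≡c′q j)))) ∑c≡0))
        vanishes′ : ∀ t → ℤΣ.sum (λ j → c′ j ℤ.* (ℤ.+ q ℤ.* Y (J j) t ℤ.+ ℤ.+ (ν (J j) ℕ.^ suc (toℕ t)))) ≡ ℤ.0ℤ
        vanishes′ t = cancel-q c′ X (trans (ℤΣ.sum-cong-≗ (λ j → cong (ℤ._* X j) (sym (c≡c′q j)))) (vanishes t))
          where
          X = λ j → ℤ.+ q ℤ.* Y (J j) t ℤ.+ ℤ.+ (ν (J j) ℕ.^ suc (toℕ t))

    q*z : ∀ i t → fromℕ q * z i t ≡ fromℤ (ℤ.+ q ℤ.* Y i t ℤ.+ ℤ.+ (ν i ℕ.^ suc (toℕ t)))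
    q*z i t = begin
      fromℕ q * (fromℤ (Y i t) + fromℕ P * 1/ℕ q)        ≡⟨ distrib (fromℕ q) (fromℤ (Y i t)) (fromℕ P) (1/ℕ q) ⟩
      fromℕ q * fromℤ (Y i t) + fromℕ P * (fromℕ q * 1/ℕ q) ≡⟨ cong (λ x → fromℕ q * fromℤ (Y i t) + fromℕ P * x) (n*1/n≡1 q) ⟩
      fromℕ q * fromℤ (Y i t) + fromℕ P * 1ℚ              ≡⟨ cong (fromℕ q * fromℤ (Y i t) +_) (*-identityʳ (fromℕ P)) ⟩
      fromℕ q * fromℤ (Y i t) + fromℕ P                   ≡⟨ cong (_+ fromℕ P) (fromℤ-homo-* (ℤ.+ q) (Y i t)) ⟨
      fromℤ (ℤ.+ q ℤ.* Y i t) + fromℕ P                   ≡⟨ fromℤ-homo-+ (ℤ.+ q ℤ.* Y i t) (ℤ.+ P) ⟨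
      fromℤ (ℤ.+ q ℤ.* Y i t ℤ.+ ℤ.+ P)                   ∎
      where
      open ≡-Reasoning
      P = ν i ℕ.^ suc (toℕ t)
      distrib : ∀ q y p r → q * (y + p * r) ≡ q * y + p * (q * r)
      distrib = solve-∀ ℚ-ring

    z-affinelyIndependent : ∀ {k} → suc k ℕ.≤ d → (J : Fin (suc (suc k)) → I) → (∀ {i j} → J i ≡ J j → i ≡ j) →
                            ¬ AffinelyDependent (z ∘ J)
    z-affinelyIndependent {k} k<d J J-injective (C , (j₀ , Cj₀≢0) , ∑C≡0 , ∑Cz≡0) =
      Cj₀≢0 (p*r≡0⇒p≡0 (fromℕ D) {{ℕ.≢-nonZero D≢0}} (trans (C*D≡c j₀) (cong fromℤ (scaled-dependencies-vanish {k} k<d J J-injective {c} equations j₀))))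
      where
      cleared = clearDenominators C
      D = proj₁ cleared
      D≢0 = proj₁ (proj₂ cleared)
      c = proj₁ (proj₂ (proj₂ cleared))
      C*D≡c = proj₂ (proj₂ (proj₂ cleared))
      equations : ScaledDependency J c
      equations = fromℤ-injective (begin
        fromℤ (ℤΣ.sum c)               ≡⟨ fromℤ-homo-sum c ⟩
        ∑[ j < suc (suc k) ] fromℤ (c j) ≡⟨ sum-cong-≗ (sym ∘ C*D≡c) ⟩
        ∑[ j < suc (suc k) ] (C j * fromℕ D) ≡⟨ *-distribʳ-sum (fromℕ D) C ⟨
        sum C * fromℕ D                ≡⟨ cong (_* fromℕ D) ∑C≡0 ⟩
        0ℚ * fromℕ D                   ≡⟨ *-zeroˡ (fromℕ D) ⟩
        0ℚ                             ∎) ,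
        λ t → fromℤ-injective (begin
        fromℤ (ℤΣ.sum (λ j → c j ℤ.* X j t))             ≡⟨ fromℤ-homo-sum (λ j → c j ℤ.* X j t) ⟩
        ∑[ j < suc (suc k) ] fromℤ (c j ℤ.* X j t)      ≡⟨ sum-cong-≗ (λ j → trans (fromℤ-homo-* (c j) (X j t))
                                                            (cong₂ _*_ (sym (C*D≡c j)) (sym (q*z (J j) t)))) ⟩
        ∑[ j < suc (suc k) ] (C j * fromℕ D * (fromℕ q * z (J j) t))
                                                        ≡⟨ sum-cong-≗ (λ j → swap (C j) (fromℕ D) (fromℕ q) (z (J j) t)) ⟩
        ∑[ j < suc (suc k) ] (fromℕ D * fromℕ q * (C j * z (J j) t))
                                                        ≡⟨ *-distribˡ-sum (fromℕ D * fromℕ q) (λ j → C j * z (J j) t) ⟨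
        fromℕ D * fromℕ q * ∑[ j < suc (suc k) ] (C j * z (J j) t) ≡⟨ cong (fromℕ D * fromℕ q *_) (∑Cz≡0 t) ⟩
        fromℕ D * fromℕ q * 0ℚ                          ≡⟨ *-zeroʳ (fromℕ D * fromℕ q) ⟩
        0ℚ                                              ∎)
        where
        open ≡-Reasoning
        X = λ j t → ℤ.+ q ℤ.* Y (J j) t ℤ.+ ℤ.+ (ν (J j) ℕ.^ suc (toℕ t))
        swap : ∀ c d q z → c * d * (q * z) ≡ d * q * (c * z)
        swap = solve-∀ ℚ-ring

    generalPosition : GeneralPosition z
    generalPosition k k<d ι ι-injective (a , v , ι∈flat) =
      z-affinelyIndependent k<d J J-injective (flat-affinelyDependent a v (z ∘ J) (ι∈flat ∘ Fin.cast 2+k≡k+2))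
      where
      2+k≡k+2 = ℕ.+-comm 2 k
      J = ι ∘ Fin.cast 2+k≡k+2
      J-injective : ∀ {i j} → J i ≡ J j → i ≡ j
      J-injective {i} {j} Ji≡Jj = begin
        i                                          ≡⟨ cast-involutive (sym 2+k≡k+2) 2+k≡k+2 i ⟨
        Fin.cast (sym 2+k≡k+2) (Fin.cast 2+k≡k+2 i) ≡⟨ cong (Fin.cast (sym 2+k≡k+2)) (ι-injective Ji≡Jj) ⟩
        Fin.cast (sym 2+k≡k+2) (Fin.cast 2+k≡k+2 j) ≡⟨ cast-involutive (sym 2+k≡k+2) 2+k≡k+2 j ⟩
        j                                          ∎
        where open ≡-Reasoning

  GeneralPosition-cong : ∀ {d} {I : Set} {y y′ : I → Point d} → (∀ i t → y i t ≡ y′ i t) →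
                         GeneralPosition y′ → GeneralPosition y
  GeneralPosition-cong y≡y′ gp k k<d ι ι-injective (a , v , ι∈flat) =
    gp k k<d ι ι-injective (a , v , λ j → proj₁ (ι∈flat j) , λ t → trans (sym (y≡y′ (ι j) t)) (proj₂ (ι∈flat j) t))

  -- The configuration
  IsInteger : ℚ → Set
  IsInteger r = Σ ℤ λ a → r ≡ fromℤ a

  isInteger-+ : ∀ {r s} → IsInteger r → IsInteger s → IsInteger (r + s)
  isInteger-+ (a , refl) (b , refl) = a ℤ.+ b , sym (fromℤ-homo-+ a b)

  isInteger-* : ∀ {r s} → IsInteger r → IsInteger s → IsInteger (r * s)
  isInteger-* (a , refl) (b , refl) = a ℤ.* b , sym (fromℤ-homo-* a b)

  isInteger-neg : ∀ {r} → IsInteger r → IsInteger (- r)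
  isInteger-neg (a , refl) = ℤ.- a , sym (fromℤ-homo-neg a)
    where
    fromℤ-homo-neg : ∀ a → fromℤ (ℤ.- a) ≡ - fromℤ a
    fromℤ-homo-neg (ℤ.+ zero)   = refl
    fromℤ-homo-neg (ℤ.+ suc a)  = refl
    fromℤ-homo-neg ℤ.-[1+ a ]   = refl

  isInteger-fromℕ : ∀ m → IsInteger (fromℕ m)
  isInteger-fromℕ m = ℤ.+ m , refl

  isInteger-δ : ∀ {n} (i k : Fin n) → IsInteger (δ i k)
  isInteger-δ zero    zero    = isInteger-fromℕ 1
  isInteger-δ zero    (suc k) = isInteger-fromℕ 0
  isInteger-δ (suc i) zero    = isInteger-fromℕ 0
  isInteger-δ (suc i) (suc k) = isInteger-δ i k

  module Configuration (e : ℕ) where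

    d n : ℕ
    d = suc e
    n = suc d

    K : ℚ
    K = fromℕ (2 ℕ.* suc n)

    V : Fin n → Fin n → ℚ
    V i k = fromℕ n * δ i k - 1ℚ

    ideal : Fin n → Fin n → Fin n → ℚ
    ideal i j k = (K - 1ℚ) * V i k + V j k - (K + K) * (δ i j * V i k)

    ideal-diag : ∀ i k → ideal i i k ≡ - (K * V i k)
    ideal-diag i k = trans (cong (λ δᵢᵢ → (K - 1ℚ) * V i k + V i k - (K + K) * (δᵢᵢ * V i k)) (δ-refl i))
                           (simplify K (V i k))
      where
      simplify : ∀ K v → (K - 1ℚ) * v + v - (K + K) * (1ℚ * v) ≡ - (K * v)
      simplify = solve-∀ ℚ-ring

    ideal-off : ∀ {i j} → j ≢ i → ∀ k → ideal i j k ≡ (K - 1ℚ) * V i k + V j k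
    ideal-off {i} {j} j≢i k = trans (cong (λ δᵢⱼ → (K - 1ℚ) * V i k + V j k - (K + K) * (δᵢⱼ * V i k)) (δ-≢ (j≢i ∘ sym)))
                                    (simplify (K - 1ℚ) (K + K) (V i k) (V j k))
      where
      simplify : ∀ a b u v → a * u + v - b * (0ℚ * u) ≡ a * u + v
      simplify = solve-∀ ℚ-ring

    ideal-isInteger : ∀ i j k → IsInteger (ideal i j k)
    ideal-isInteger i j k =
      isInteger-+ (isInteger-+ (isInteger-* K-1-isInteger (V-isInteger i k)) (V-isInteger j k))
                  (isInteger-neg (isInteger-* (isInteger-+ K-isInteger K-isInteger)
                                              (isInteger-* (isInteger-δ i j) (V-isInteger i k))))
      where
      K-isInteger = isInteger-fromℕ (2 ℕ.* suc n)
      K-1-isInteger = isInteger-+ K-isInteger (isInteger-neg (isInteger-fromℕ 1))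
      V-isInteger : ∀ i k → IsInteger (V i k)
      V-isInteger i k = isInteger-+ (isInteger-* (isInteger-fromℕ n) (isInteger-δ i k)) (isInteger-neg (isInteger-fromℕ 1))

    sum-V : ∀ i → sum (V i) ≡ 0ℚ
    sum-V i = begin
      ∑[ k < n ] (fromℕ n * δ i k - 1ℚ)          ≡⟨ sum-sub (λ k → fromℕ n * δ i k) (λ _ → 1ℚ) ⟩
      ∑[ k < n ] (fromℕ n * δ i k) - ∑[ k < n ] 1ℚ ≡⟨ cong₂ _-_ (sym (*-distribˡ-sum (fromℕ n) (δ i))) (sum-const n 1ℚ) ⟩
      fromℕ n * sum (δ i) - fromℕ n * 1ℚ          ≡⟨ cong (λ s → fromℕ n * s - fromℕ n * 1ℚ) ∑δ≡1 ⟩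
      fromℕ n * 1ℚ - fromℕ n * 1ℚ                 ≡⟨ +-inverseʳ (fromℕ n * 1ℚ) ⟩
      0ℚ                                          ∎
      where
      open ≡-Reasoning
      ∑δ≡1 : sum (δ i) ≡ 1ℚ
      ∑δ≡1 = trans (sum-cong-≗ (λ k → sym (*-identityˡ (δ i k)))) (sum-δ (λ _ → 1ℚ) i)

    sum-ideal : ∀ i j → sum (ideal i j) ≡ 0ℚ
    sum-ideal i j = begin
      ∑[ k < n ] ideal i j k                     ≡⟨ sum-cong-≗ (λ k → regroup (K - 1ℚ) (K + K) (δ i j) (V i k) (V j k)) ⟩
      ∑[ k < n ] (a * V i k + V j k)             ≡⟨ ∑-distrib-+ (λ k → a * V i k) (V j) ⟩
      ∑[ k < n ] (a * V i k) + sum (V j)         ≡⟨ cong₂ _+_ (sym (*-distribˡ-sum a (V i))) (sum-V j) ⟩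
      a * sum (V i) + 0ℚ                         ≡⟨ cong (λ s → a * s + 0ℚ) (sum-V i) ⟩
      a * 0ℚ + 0ℚ                                ≡⟨ vanish a ⟩
      0ℚ                                         ∎
      where
      open ≡-Reasoning
      a = K - 1ℚ - (K + K) * δ i j
      regroup : ∀ b c δ u v → b * u + v - c * (δ * u) ≡ (b - c * δ) * u + v
      regroup = solve-∀ ℚ-ring
      vanish : ∀ a → a * 0ℚ + 0ℚ ≡ 0ℚ
      vanish = solve-∀ ℚ-ring

    -- fromℕ S = 2 K d − n (see S+n≡2Kd), written as a polynomial in e to avoid truncated subtraction.
    -- B′ = 1 + 2 K bounds the barycentric forms, and Rη makes (4 n B′) η = 1 / (2 S) in `margin`.
    B′ S Rη : ℕ
    B′ = suc (4 ℕ.* suc n)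
    S  = suc (e ℕ.* (4 ℕ.* e ℕ.+ 15) ℕ.+ 9)
    Rη = (n ℕ.* 2 ℕ.+ n ℕ.* 2) ℕ.* B′ ℕ.* (2 ℕ.* S)

    S+n≡2Kd : fromℕ S + fromℕ n ≡ (K + K) * fromℕ d
    S+n≡2Kd = begin
      fromℕ S + fromℕ n                                  ≡⟨ fromℕ-homo-+ S n ⟨
      fromℕ (S ℕ.+ n)                                    ≡⟨ cong fromℕ (polynomial e) ⟩
      fromℕ (2 ℕ.* suc n ℕ.* d ℕ.+ 2 ℕ.* suc n ℕ.* d)     ≡⟨ fromℕ-homo-+ (2 ℕ.* suc n ℕ.* d) _ ⟩
      fromℕ (2 ℕ.* suc n ℕ.* d) + fromℕ (2 ℕ.* suc n ℕ.* d) ≡⟨ cong₂ _+_ (fromℕ-homo-* (2 ℕ.* suc n) d) (fromℕ-homo-* (2 ℕ.* suc n) d) ⟩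
      K * fromℕ d + K * fromℕ d                          ≡⟨ *-distribʳ-+ (fromℕ d) K K ⟨
      (K + K) * fromℕ d                                  ∎
      where
      open ≡-Reasoning
      polynomial : ∀ e → suc (e ℕ.* (4 ℕ.* e ℕ.+ 15) ℕ.+ 9) ℕ.+ suc (suc e)
                         ≡ 2 ℕ.* suc (suc (suc e)) ℕ.* suc e ℕ.+ 2 ℕ.* suc (suc (suc e)) ℕ.* suc e
      polynomial = ℕ-Solver.solve-∀

    2+n≤K : fromℕ 2 + fromℕ n ≤ K
    2+n≤K = ≤-trans (≤-reflexive (sym (fromℕ-homo-+ 2 n)))
                    (fromℕ-mono-≤ (ℕ.≤-trans (ℕ.m≤m+n (2 ℕ.+ n) n) (ℕ.≤-reflexive (twice n))))
      where
      twice : ∀ n → 2 ℕ.+ n ℕ.+ n ≡ 2 ℕ.* suc n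
      twice = ℕ-Solver.solve-∀

    0≤K : 0ℚ ≤ K
    0≤K = 0≤fromℕ (2 ℕ.* suc n)

    Index : Set
    Index = Maybe (Fin n × Fin n)

    N : ℕ
    N = suc (n ℕ.* n)

    node : Index → ℕ
    node nothing        = 0
    node (just (i , j)) = suc (toℕ (Fin.combine i j))

    node-injective : ∀ {a b} → node a ≡ node b → a ≡ b
    node-injective {nothing}      {nothing}      _ = refl
    node-injective {just (i , j)} {just (k , l)} eq
      with combine-injective i j k l (toℕ-injective (ℕ.suc-injective eq))
    ... | refl , refl = refl

    node<N : ∀ a → node a ℕ.< N
    node<N nothing        = s≤s z≤n
    node<N (just (i , j)) = s≤s (toℕ<n (Fin.combine i j))

    Y : Index → Fin d → ℤ
    Y nothing        t = ℤ.0ℤ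
    Y (just (i , j)) t = proj₁ (ideal-isInteger i j (suc t))

    R : ℕ
    R = N ℕ.^ d ℕ.* (d ℕ.* Rη)

    instance
      R-nonZero : ℕ.NonZero R
      R-nonZero = ℕ.m*n≢0 (N ℕ.^ d) (d ℕ.* Rη) {{ℕ.m^n≢0 N d}}

    open MomentCurvePerturbation Y node node-injective N R node<N using (q; z; generalPosition)

    x : Fin n → Fin n → Point d
    x i j = z (just (i , j))

    p : Point d
    p _ = 0ℚ

    w : Index → Point d
    w a t = fromℕ (node a ℕ.^ suc (toℕ t)) * 1/ℕ q

    x≡ideal+w : ∀ i j t → x i j t ≡ ideal i j (suc t) + w (just (i , j)) t
    x≡ideal+w i j t = cong (_+ w (just (i , j)) t) (sym (proj₂ (ideal-isInteger i j (suc t))))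

    withPoint≡z : ∀ a t → withPoint p x a t ≡ z a t
    withPoint≡z nothing        t = sym (trans (+-identityˡ _) (*-zeroˡ (1/ℕ q)))
    withPoint≡z (just (i , j)) t = refl

    η : ℚ
    η = 1/ℕ Rη

    n≤Rη : n ℕ.≤ Rη
    n≤Rη = ℕ.≤-trans (ℕ.m≤m*n n 2) (ℕ.≤-trans (ℕ.m≤m+n (n ℕ.* 2) (n ℕ.* 2))
             (ℕ.≤-trans (ℕ.m≤m*n (n ℕ.* 2 ℕ.+ n ℕ.* 2) B′) (ℕ.m≤m*n ((n ℕ.* 2 ℕ.+ n ℕ.* 2) ℕ.* B′) (2 ℕ.* S))))

    nη≤1 : fromℕ n * η ≤ 1ℚ
    nη≤1 = a*c≤b⇒a/b≤1/c n Rη 1 (ℕ.≤-trans (ℕ.≤-reflexive (ℕ.*-identityʳ n)) n≤Rη)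

    η≤1 : η ≤ 1ℚ
    η≤1 = ≤-trans (≤-reflexive (sym (*-identityˡ η))) (a*c≤b⇒a/b≤1/c 1 Rη 1 (ℕ.≤-trans (s≤s z≤n) n≤Rη))

    0≤w : ∀ a t → 0ℚ ≤ w a t
    0≤w a t = 0≤* (0≤fromℕ (node a ℕ.^ suc (toℕ t))) (0≤1/ℕ q)

    w≤η/d : ∀ a t → w a t ≤ 1/ℕ (d ℕ.* Rη)
    w≤η/d a t = a*c≤b⇒a/b≤1/c (node a ℕ.^ suc (toℕ t)) q (d ℕ.* Rη) (ℕ.≤-trans (ℕ.*-monoˡ-≤ (d ℕ.* Rη) node^s≤N^d)
                                       (ℕ.≤-trans (ℕ.m≤n*m R (N !) {{N ℕ.!≢0}}) (ℕ.n≤1+n _)))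
      where
      node^s≤N^d : node a ℕ.^ suc (toℕ t) ℕ.≤ N ℕ.^ d
      node^s≤N^d = ℕ.≤-trans (ℕ.^-monoˡ-≤ (suc (toℕ t)) (ℕ.<⇒≤ (node<N a))) (ℕ.^-monoʳ-≤ N (toℕ<n t))

    ∣lift-w∣≤η : ∀ a k → ∣ lift (w a) k ∣ ≤ η
    ∣lift-w∣≤η a zero = begin
      ∣ - sum (w a) ∣                       ≡⟨ ∣-p∣≡∣p∣ (sum (w a)) ⟩
      ∣ sum (w a) ∣                         ≡⟨ 0≤p⇒∣p∣≡p (sum-nonNeg (0≤w a)) ⟩
      sum (w a)                             ≤⟨ sum-≤-const (1/ℕ (d ℕ.* Rη)) (w≤η/d a) ⟩
      fromℕ d * 1/ℕ (d ℕ.* Rη)              ≡⟨ *-1/ℕ-cancel d Rη ⟩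
      η                                     ∎
      where open ≤-Reasoning
    ∣lift-w∣≤η a (suc t) = begin
      ∣ w a t ∣                             ≡⟨ 0≤p⇒∣p∣≡p (0≤w a t) ⟩
      w a t                                 ≤⟨ w≤η/d a t ⟩
      1/ℕ (d ℕ.* Rη)                        ≡⟨ *-identityˡ _ ⟨
      fromℕ 1 * 1/ℕ (d ℕ.* Rη)              ≤⟨ a*c≤b⇒a/b≤1/c 1 (d ℕ.* Rη) Rη (ℕ.≤-trans (ℕ.≤-reflexive (ℕ.*-identityˡ Rη)) (ℕ.m≤n*m Rη d)) ⟩
      η                                     ∎
      where open ≤-Reasoning

    lift-x : ∀ i j k → lift (x i j) k ≡ ideal i j k + lift (w (just (i , j))) k
    lift-x i j zero = begin
      - sum (x i j)                                    ≡⟨ cong -_ (sum-cong-≗ (x≡ideal+w i j)) ⟩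
      - ∑[ t < d ] (ideal i j (suc t) + w (just (i , j)) t) ≡⟨ cong -_ (∑-distrib-+ (ideal i j ∘ suc) (w (just (i , j)))) ⟩
      - (sum (ideal i j ∘ suc) + sum (w (just (i , j))))     ≡⟨ neg-distrib-+ (sum (ideal i j ∘ suc)) (sum (w (just (i , j)))) ⟩
      - sum (ideal i j ∘ suc) + - sum (w (just (i , j)))
        ≡⟨ cong (_+ - sum (w (just (i , j)))) (sym (inverseˡ-unique (ideal i j zero) (sum (ideal i j ∘ suc)) (sum-ideal i j))) ⟩
      ideal i j zero + - sum (w (just (i , j)))              ∎
      where open ≡-Reasoning
    lift-x i j (suc t) = x≡ideal+w i j t

    ∣V-V∣≤n : ∀ a b t → ∣ V a t - V b t ∣ ≤ fromℕ n
    ∣V-V∣≤n a b t = begin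
      ∣ V a t - V b t ∣                         ≡⟨ cong ∣_∣ (factor (fromℕ n) (δ a t) (δ b t)) ⟩
      ∣ fromℕ n * (δ a t - δ b t) ∣             ≡⟨ ∣p*q∣≡∣p∣*∣q∣ (fromℕ n) (δ a t - δ b t) ⟩
      ∣ fromℕ n ∣ * ∣ δ a t - δ b t ∣           ≤⟨ *-monoˡ-≤-0≤ (0≤∣p∣ (fromℕ n)) (∣δ-δ∣≤1 a b) ⟩
      ∣ fromℕ n ∣ * 1ℚ                          ≡⟨ trans (*-identityʳ ∣ fromℕ n ∣) (0≤p⇒∣p∣≡p (0≤fromℕ n)) ⟩
      fromℕ n                                   ∎
      where
      open ≤-Reasoning
      factor : ∀ N x y → (N * x - 1ℚ) - (N * y - 1ℚ) ≡ N * (x - y)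
      factor = solve-∀ ℚ-ring
      ∣δ-δ∣≤1 : ∀ a b → ∣ δ a t - δ b t ∣ ≤ 1ℚ
      ∣δ-δ∣≤1 a b with a Fin.≟ t | b Fin.≟ t
      ... | yes refl | yes refl = ≤-trans (≤-reflexive (cong ∣_∣ (+-inverseʳ (δ a a)))) (0≤fromℕ 1)
      ... | yes refl | no b≢a   = ≤-reflexive (cong ∣_∣ (cong₂ _-_ (δ-refl a) (δ-≢ b≢a)))
      ... | no a≢b   | yes refl = ≤-reflexive (cong ∣_∣ (cong₂ _-_ (δ-≢ a≢b) (δ-refl b)))
      ... | no a≢t   | no b≢t   = ≤-trans (≤-reflexive (cong ∣_∣ (cong₂ _-_ (δ-≢ a≢t) (δ-≢ b≢t)))) (0≤fromℕ 1)

    ι κ : ℚ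
    ι = 1/ℕ n
    κ = 1/ℕ (2 ℕ.* suc n)

    originForm : ℚ → Fin n → AffineForm n
    originForm σ j = form₂ ι (σ * (ι * κ)) j 0ℚ j

    near-σKV⇒p∈Conv : ∀ σ → σ * σ ≡ 1ℚ → ∣ σ ∣ ≡ 1ℚ → (y : Fin n → Point d) →
                 (∀ k t → ∣ lift (y k) t - σ * (K * V k t) ∣ ≤ fromℕ (suc n)) → p ∈Conv y
    near-σKV⇒p∈Conv σ σ²≡1 ∣σ∣≡1 y y≈σKV =
      perturbed-simplex-contains y (λ k t → σ * (K * V k t)) (originForm σ) 0≤ικ (0≤fromℕ (suc n))
        ‖originForm‖≤ικ biorthogonal y≈σKV (≤-reflexive small) p (λ j → ≤-reflexive (trans (cong ∣_∣ (value-at-p j)) (0≤p⇒∣p∣≡p 0≤ι)))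
        (λ j → ≤-reflexive (trans margin (sym (value-at-p j))))
      where
      0≤ι = 0≤1/ℕ n
      0≤ικ = 0≤* 0≤ι (0≤1/ℕ (2 ℕ.* suc n))
      ‖originForm‖≤ικ : ∀ j → ‖ originForm σ j ‖ ≤ ι * κ
      ‖originForm‖≤ικ j = ≤-trans (‖form₂‖≤ ι (σ * (ι * κ)) j 0ℚ j) (≤-reflexive (begin-equality
        ∣ σ * (ι * κ) ∣ + ∣ 0ℚ ∣   ≡⟨ +-identityʳ _ ⟩
        ∣ σ * (ι * κ) ∣            ≡⟨ ∣p*q∣≡∣p∣*∣q∣ σ (ι * κ) ⟩
        ∣ σ ∣ * ∣ ι * κ ∣          ≡⟨ cong₂ _*_ ∣σ∣≡1 (0≤p⇒∣p∣≡p 0≤ικ) ⟩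
        1ℚ * (ι * κ)               ≡⟨ *-identityˡ (ι * κ) ⟩
        ι * κ                      ∎))
        where open ≤-Reasoning
      biorthogonal : ∀ j k → originForm σ j ⟪ (λ t → σ * (K * V k t)) ⟫ ≡ δ j k
      biorthogonal j k = begin
        originForm σ j ⟪ (λ t → σ * (K * V k t)) ⟫    ≡⟨ form₂-⟪⟫ ι (σ * (ι * κ)) j 0ℚ j (λ t → σ * (K * V k t)) ⟩
        ι + σ * (ι * κ) * (σ * (K * (fromℕ n * δ k j - 1ℚ))) + 0ℚ * (σ * (K * (fromℕ n * δ k j - 1ℚ)))
          ≡⟨ regroup ι σ κ K (fromℕ n) (δ k j) ⟩
        δ k j + (σ * σ * (K * κ) - 1ℚ) * ι * (fromℕ n * δ k j - 1ℚ) + (fromℕ n * ι - 1ℚ) * δ k j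
          ≡⟨ cong₃ (λ a b c → δ k j + (a * b - 1ℚ) * ι * (fromℕ n * δ k j - 1ℚ) + (c - 1ℚ) * δ k j)
                    σ²≡1 (n*1/n≡1 (2 ℕ.* suc n)) (n*1/n≡1 n) ⟩
        δ k j + (1ℚ * 1ℚ - 1ℚ) * ι * (fromℕ n * δ k j - 1ℚ) + (1ℚ - 1ℚ) * δ k j
          ≡⟨ vanish (δ k j) ι (fromℕ n * δ k j - 1ℚ) ⟩
        δ k j                                         ≡⟨ δ-sym k j ⟩
        δ j k                                         ∎
        where
        open ≡-Reasoning
        regroup : ∀ ι σ κ K N δ → ι + σ * (ι * κ) * (σ * (K * (N * δ - 1ℚ))) + 0ℚ * (σ * (K * (N * δ - 1ℚ)))
                                  ≡ δ + (σ * σ * (K * κ) - 1ℚ) * ι * (N * δ - 1ℚ) + (N * ι - 1ℚ) * δ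
        regroup = solve-∀ ℚ-ring
        vanish : ∀ δ ι v → δ + (1ℚ * 1ℚ - 1ℚ) * ι * v + (1ℚ - 1ℚ) * δ ≡ δ
        vanish = solve-∀ ℚ-ring
      κ≡½ι′ : κ ≡ ½ * 1/ℕ (suc n)
      κ≡½ι′ = 1/ℕ-homo-* 2 (suc n)
      small : fromℕ n * (ι * κ * fromℕ (suc n)) ≡ ½
      small = begin
        fromℕ n * (ι * κ * fromℕ (suc n))                   ≡⟨ cong (λ κ → fromℕ n * (ι * κ * fromℕ (suc n))) κ≡½ι′ ⟩
        fromℕ n * (ι * (½ * 1/ℕ (suc n)) * fromℕ (suc n))   ≡⟨ regroup (fromℕ n) ι (1/ℕ (suc n)) (fromℕ (suc n)) ⟩
        (fromℕ n * ι) * (fromℕ (suc n) * 1/ℕ (suc n)) * ½   ≡⟨ cong₂ (λ a b → a * b * ½) (n*1/n≡1 n) (n*1/n≡1 (suc n)) ⟩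
        1ℚ * 1ℚ * ½                                         ≡⟨ *-identityˡ (1ℚ * ½) ⟩
        1ℚ * ½                                              ≡⟨ *-identityˡ ½ ⟩
        ½                                                   ∎
        where
        open ≡-Reasoning
        regroup : ∀ N ι ι′ M → N * (ι * (½ * ι′) * M) ≡ (N * ι) * (M * ι′) * ½
        regroup = solve-∀ ℚ-ring
      value-at-p : ∀ j → originForm σ j ⟪ lift p ⟫ ≡ ι
      value-at-p j = begin
        originForm σ j ⟪ lift p ⟫                          ≡⟨ form₂-⟪⟫ ι (σ * (ι * κ)) j 0ℚ j (lift p) ⟩
        ι + σ * (ι * κ) * lift p j + 0ℚ * lift p j         ≡⟨ cong (λ v → ι + σ * (ι * κ) * v + 0ℚ * v) (lift-0 j) ⟩
        ι + σ * (ι * κ) * 0ℚ + 0ℚ * 0ℚ                     ≡⟨ vanish ι (σ * (ι * κ)) ⟩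
        ι                                                  ∎
        where
        open ≡-Reasoning
        vanish : ∀ ι c → ι + c * 0ℚ + 0ℚ * 0ℚ ≡ ι
        vanish = solve-∀ ℚ-ring
      margin : (fromℕ n * ι + fromℕ n * ι) * (ι * κ * fromℕ (suc n)) ≡ ι
      margin = begin
        (fromℕ n * ι + fromℕ n * ι) * (ι * κ * fromℕ (suc n))
          ≡⟨ cong (λ κ → (fromℕ n * ι + fromℕ n * ι) * (ι * κ * fromℕ (suc n))) κ≡½ι′ ⟩
        (fromℕ n * ι + fromℕ n * ι) * (ι * (½ * 1/ℕ (suc n)) * fromℕ (suc n))
          ≡⟨ regroup (fromℕ n * ι + fromℕ n * ι) ι (1/ℕ (suc n)) (fromℕ (suc n)) ⟩
        (fromℕ n * ι + fromℕ n * ι) * ι * ½ * (fromℕ (suc n) * 1/ℕ (suc n))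
          ≡⟨ cong₂ (λ a b → (a + a) * ι * ½ * b) (n*1/n≡1 n) (n*1/n≡1 (suc n)) ⟩
        (1ℚ + 1ℚ) * ι * ½ * 1ℚ
          ≡⟨ halve ι ⟩
        ι ∎
        where
        open ≡-Reasoning
        regroup : ∀ a ι ι′ M → a * (ι * (½ * ι′) * M) ≡ a * ι * ½ * (M * ι′)
        regroup = solve-∀ ℚ-ring
        halve : ∀ ι → (1ℚ + 1ℚ) * ι * ½ * 1ℚ ≡ ι
        halve = solve-∀ ℚ-ring

    derangement-contains : (c : Fin n → Fin n) → (∀ i → c i ≢ i) → p ∈Conv (λ i → x i (c i))
    derangement-contains c c≢id = near-σKV⇒p∈Conv 1ℚ refl refl (λ i → x i (c i)) close
      where
      close : ∀ k t → ∣ lift (x k (c k)) t - 1ℚ * (K * V k t) ∣ ≤ fromℕ (suc n)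
      close k t = begin
        ∣ lift (x k (c k)) t - 1ℚ * (K * V k t) ∣
          ≡⟨ cong (λ l → ∣ l - 1ℚ * (K * V k t) ∣) (lift-x k (c k) t) ⟩
        ∣ ideal k (c k) t + lw - 1ℚ * (K * V k t) ∣
          ≡⟨ cong (λ y → ∣ y + lw - 1ℚ * (K * V k t) ∣) (ideal-off (c≢id k) t) ⟩
        ∣ (K - 1ℚ) * V k t + V (c k) t + lw - 1ℚ * (K * V k t) ∣
          ≡⟨ cong ∣_∣ (regroup K (V k t) (V (c k) t) lw) ⟩
        ∣ (V (c k) t - V k t) + lw ∣
          ≤⟨ ∣p+q∣≤∣p∣+∣q∣ (V (c k) t - V k t) lw ⟩
        ∣ V (c k) t - V k t ∣ + ∣ lw ∣
          ≤⟨ +-mono-≤ (∣V-V∣≤n (c k) k t) (≤-trans (∣lift-w∣≤η (just (k , c k)) t) η≤1) ⟩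
        fromℕ n + 1ℚ
          ≡⟨ trans (+-comm (fromℕ n) 1ℚ) (sym (fromℕ-homo-+ 1 n)) ⟩
        fromℕ (suc n) ∎
        where
        open ≤-Reasoning
        lw = lift (w (just (k , c k))) t
        regroup : ∀ K v u l → (K - 1ℚ) * v + u + l - 1ℚ * (K * v) ≡ (u - v) + l
        regroup = solve-∀ ℚ-ring

    identity-contains : (c : Fin n → Fin n) → (∀ i → c i ≡ i) → p ∈Conv (λ i → x i (c i))
    identity-contains c c≗id = near-σKV⇒p∈Conv (- 1ℚ) refl refl (λ i → x i (c i)) close
      where
      close : ∀ k t → ∣ lift (x k (c k)) t - - 1ℚ * (K * V k t) ∣ ≤ fromℕ (suc n)
      close k t = begin
        ∣ lift (x k (c k)) t - - 1ℚ * (K * V k t) ∣    ≡⟨ cong (λ l → ∣ l - - 1ℚ * (K * V k t) ∣) (lift-x k (c k) t) ⟩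
        ∣ ideal k (c k) t + lw - - 1ℚ * (K * V k t) ∣  ≡⟨ cong (λ y → ∣ y + lw - - 1ℚ * (K * V k t) ∣)
                                                            (trans (cong (λ j → ideal k j t) (c≗id k)) (ideal-diag k t)) ⟩
        ∣ - (K * V k t) + lw - - 1ℚ * (K * V k t) ∣    ≡⟨ cong ∣_∣ (cancel (K * V k t) lw) ⟩
        ∣ lw ∣                                         ≤⟨ ∣lift-w∣≤η (just (k , c k)) t ⟩
        η                                              ≤⟨ η≤1 ⟩
        1ℚ                                             ≤⟨ fromℕ-mono-≤ (s≤s z≤n) ⟩
        fromℕ (suc n)                                  ∎
        where
        open ≤-Reasoning
        lw = lift (w (just (k , c k))) t
        cancel : ∀ v l → - v + l - - 1ℚ * v ≡ l
        cancel = solve-∀ ℚ-ring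

    -- g sums the coordinates of the colours moved by c: it is at least 1 at every chosen point, but 0 at p.
    module Mixed (c : Fin n → Fin n) {i₁ i₂} (c-fixes-i₁ : c i₁ ≡ i₁) (c-moves-i₂ : c i₂ ≢ i₂) where

      χ : Fin n → ℚ
      χ k with c k Fin.≟ k
      ... | yes _ = 0ℚ
      ... | no  _ = 1ℚ

      χ-fixed : ∀ {k} → c k ≡ k → χ k ≡ 0ℚ
      χ-fixed {k} ck≡k with c k Fin.≟ k
      ... | yes _    = refl
      ... | no ck≢k  = ⊥-elim (ck≢k ck≡k)

      χ-moved : ∀ {k} → c k ≢ k → χ k ≡ 1ℚ
      χ-moved {k} ck≢k with c k Fin.≟ k
      ... | yes ck≡k = ⊥-elim (ck≢k ck≡k)
      ... | no _     = refl

      0≤χ : ∀ k → 0ℚ ≤ χ k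
      0≤χ k with c k Fin.≟ k
      ... | yes _ = ≤-refl
      ... | no  _ = 0≤fromℕ 1

      χ≤1 : ∀ k → χ k ≤ 1ℚ
      χ≤1 k with c k Fin.≟ k
      ... | yes _ = 0≤fromℕ 1
      ... | no  _ = ≤-refl

      moved : ℚ
      moved = sum χ

      1≤moved : 1ℚ ≤ moved
      1≤moved = ≤-trans (≤-reflexive (sym (χ-moved c-moves-i₂))) (≤-sum 0≤χ i₂)

      moved≤d : moved ≤ fromℕ d
      moved≤d = begin
        sum χ                                  ≡⟨ sum-remove {i = i₁} χ ⟩
        χ i₁ + ∑[ k < d ] χ (punchIn i₁ k)     ≤⟨ +-mono-≤ (≤-reflexive (χ-fixed c-fixes-i₁)) (sum-≤-const 1ℚ (χ≤1 ∘ punchIn i₁)) ⟩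
        0ℚ + fromℕ d * 1ℚ                      ≡⟨ trans (+-identityˡ _) (*-identityʳ (fromℕ d)) ⟩
        fromℕ d                                ∎
        where open ≤-Reasoning

      g : AffineForm n
      g = affineForm 0ℚ χ

      linear-g-V : ∀ j → linear g (V j) ≡ fromℕ n * χ j - moved
      linear-g-V j = begin
        ∑[ k < n ] (χ k * (fromℕ n * δ j k - 1ℚ))            ≡⟨ sum-cong-≗ (λ k → distrib (χ k) (fromℕ n) (δ j k)) ⟩
        ∑[ k < n ] (fromℕ n * (χ k * δ j k) - χ k)           ≡⟨ sum-sub (λ k → fromℕ n * (χ k * δ j k)) χ ⟩
        ∑[ k < n ] (fromℕ n * (χ k * δ j k)) - moved         ≡⟨ cong (_- moved) (sym (*-distribˡ-sum (fromℕ n) (λ k → χ k * δ j k))) ⟩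
        fromℕ n * ∑[ k < n ] (χ k * δ j k) - moved           ≡⟨ cong (λ s → fromℕ n * s - moved) (sum-δ χ j) ⟩
        fromℕ n * χ j - moved                                ∎
        where
        open ≡-Reasoning
        distrib : ∀ χ N δ → χ * (N * δ - 1ℚ) ≡ N * (χ * δ) - χ
        distrib = solve-∀ ℚ-ring

      linear-g-ideal-fixed : ∀ {i} → c i ≡ i → fromℕ 2 ≤ linear g (ideal i (c i))
      linear-g-ideal-fixed {i} ci≡i = begin
        fromℕ 2                                  ≤⟨ ≤-trans (≤-reflexive (sym (+-identityʳ (fromℕ 2))))
                                                      (≤-trans (+-monoʳ-≤ (fromℕ 2) (0≤fromℕ n)) 2+n≤K) ⟩
        K                                        ≡⟨ *-identityʳ K ⟨
        K * 1ℚ                                   ≤⟨ *-monoˡ-≤-0≤ 0≤K 1≤moved ⟩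
        K * moved                                ≡⟨ simplify K (fromℕ n) moved ⟨
        - K * (fromℕ n * 0ℚ - moved) + 0ℚ * (fromℕ n * 0ℚ - moved)
                                                 ≡⟨ cong (λ χᵢ → - K * (fromℕ n * χᵢ - moved) + 0ℚ * (fromℕ n * χᵢ - moved)) (χ-fixed ci≡i) ⟨
        - K * (fromℕ n * χ i - moved) + 0ℚ * (fromℕ n * χ i - moved)
                                                 ≡⟨ cong (λ l → - K * l + 0ℚ * l) (linear-g-V i) ⟨
        - K * linear g (V i) + 0ℚ * linear g (V i) ≡⟨ linear-combination g (- K) 0ℚ (V i) (V i) ⟨
        linear g (λ k → - K * V i k + 0ℚ * V i k) ≡⟨ sum-cong-≗ (λ k → cong (χ k *_) (trans (cong (λ j → ideal i j k) ci≡i)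
                                                                                (trans (ideal-diag i k) (split K (V i k))))) ⟨
        linear g (ideal i (c i))                  ∎
        where
        open ≤-Reasoning
        simplify : ∀ K N m → - K * (N * 0ℚ - m) + 0ℚ * (N * 0ℚ - m) ≡ K * m
        simplify = solve-∀ ℚ-ring
        split : ∀ K v → - (K * v) ≡ - K * v + 0ℚ * v
        split = solve-∀ ℚ-ring
      linear-g-ideal-moved : ∀ {i} → c i ≢ i → fromℕ 2 ≤ linear g (ideal i (c i))
      linear-g-ideal-moved {i} ci≢i = begin
        fromℕ 2                                       ≤⟨ 2≤K-1-d ⟩
        (K - 1ℚ) * 1ℚ + (0ℚ - fromℕ d)                ≤⟨ +-mono-≤ (*-monoˡ-≤-0≤ 0≤K-1 1≤n-moved) -d≤ ⟩
        (K - 1ℚ) * (fromℕ n * 1ℚ - moved) + 1ℚ * (fromℕ n * χ (c i) - moved)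
                                                      ≡⟨ cong (λ χᵢ → (K - 1ℚ) * (fromℕ n * χᵢ - moved) + 1ℚ * (fromℕ n * χ (c i) - moved))
                                                              (χ-moved ci≢i) ⟨
        (K - 1ℚ) * (fromℕ n * χ i - moved) + 1ℚ * (fromℕ n * χ (c i) - moved)
                                                      ≡⟨ cong₂ (λ a b → (K - 1ℚ) * a + 1ℚ * b) (linear-g-V i) (linear-g-V (c i)) ⟨
        (K - 1ℚ) * linear g (V i) + 1ℚ * linear g (V (c i)) ≡⟨ linear-combination g (K - 1ℚ) 1ℚ (V i) (V (c i)) ⟨
        linear g (λ k → (K - 1ℚ) * V i k + 1ℚ * V (c i) k)
                                                      ≡⟨ sum-cong-≗ (λ k → cong (χ k *_) (trans (ideal-off ci≢i k)
                                                            (cong ((K - 1ℚ) * V i k +_) (sym (*-identityˡ (V (c i) k)))))) ⟨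
        linear g (ideal i (c i))                      ∎
        where
        open ≤-Reasoning
        n≡1+d : fromℕ n ≡ 1ℚ + fromℕ d
        n≡1+d = fromℕ-homo-+ 1 d
        0≤K-1 : 0ℚ ≤ K - 1ℚ
        0≤K-1 = ≤-trans (≤-reflexive (sym (+-inverseʳ 1ℚ)))
                  (+-monoˡ-≤ (- 1ℚ) (≤-trans (fromℕ-mono-≤ (s≤s z≤n)) (≤-trans (≤-reflexive (sym (+-identityʳ (fromℕ 2))))
                    (≤-trans (+-monoʳ-≤ (fromℕ 2) (0≤fromℕ n)) 2+n≤K))))
        1≤n-moved : 1ℚ ≤ fromℕ n * 1ℚ - moved
        1≤n-moved = begin
          1ℚ                         ≡⟨ cancel (fromℕ d) ⟨
          (1ℚ + fromℕ d) * 1ℚ - fromℕ d ≡⟨ cong (λ N → N * 1ℚ - fromℕ d) n≡1+d ⟨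
          fromℕ n * 1ℚ - fromℕ d     ≤⟨ +-monoʳ-≤ (fromℕ n * 1ℚ) (neg-antimono-≤ moved≤d) ⟩
          fromℕ n * 1ℚ - moved       ∎
          where
          cancel : ∀ d → (1ℚ + d) * 1ℚ - d ≡ 1ℚ
          cancel = solve-∀ ℚ-ring
        -d≤ : 0ℚ - fromℕ d ≤ 1ℚ * (fromℕ n * χ (c i) - moved)
        -d≤ = ≤-trans (+-mono-≤ (0≤* (0≤fromℕ n) (0≤χ (c i))) (neg-antimono-≤ moved≤d))
                      (≤-reflexive (sym (*-identityˡ _)))
        2≤K-1-d : fromℕ 2 ≤ (K - 1ℚ) * 1ℚ + (0ℚ - fromℕ d)
        2≤K-1-d = begin
          fromℕ 2
            ≤⟨ p+q≤r⇒p≤r-q {fromℕ 2} {1ℚ + fromℕ d} {K} (≤-trans (≤-reflexive (cong (fromℕ 2 +_) (sym n≡1+d))) 2+n≤K) ⟩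
          K - (1ℚ + fromℕ d)              ≡⟨ regroup K (fromℕ d) ⟩
          (K - 1ℚ) * 1ℚ + (0ℚ - fromℕ d)  ∎
          where
          regroup : ∀ K d → K - (1ℚ + d) ≡ (K - 1ℚ) * 1ℚ + (0ℚ - d)
          regroup = solve-∀ ℚ-ring

      linear-g-ideal : ∀ i → fromℕ 2 ≤ linear g (ideal i (c i))
      linear-g-ideal i = [ linear-g-ideal-fixed , linear-g-ideal-moved ]′ (toSum (c i Fin.≟ i))

      -1≤linear-g-w : ∀ a → - 1ℚ ≤ linear g (lift (w a))
      -1≤linear-g-w a = ∣p∣≤r⇒-r≤p (begin
        ∣ ∑[ k < n ] (χ k * lift (w a) k) ∣   ≤⟨ ∣sum∣≤sum∣∣ (λ k → χ k * lift (w a) k) ⟩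
        ∑[ k < n ] ∣ χ k * lift (w a) k ∣     ≤⟨ sum-≤-const η bound ⟩
        fromℕ n * η                           ≤⟨ nη≤1 ⟩
        1ℚ                                    ∎)
        where
        open ≤-Reasoning
        bound : ∀ k → ∣ χ k * lift (w a) k ∣ ≤ η
        bound k = begin
          ∣ χ k * lift (w a) k ∣        ≡⟨ ∣p*q∣≡∣p∣*∣q∣ (χ k) (lift (w a) k) ⟩
          ∣ χ k ∣ * ∣ lift (w a) k ∣    ≤⟨ *-monoʳ-≤-0≤ (0≤∣p∣ _) (≤-trans (≤-reflexive (0≤p⇒∣p∣≡p (0≤χ k))) (χ≤1 k)) ⟩
          1ℚ * ∣ lift (w a) k ∣         ≡⟨ *-identityˡ _ ⟩
          ∣ lift (w a) k ∣              ≤⟨ ∣lift-w∣≤η a k ⟩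
          η                             ∎

      1≤g⟪lift-x⟫ : ∀ i → 1ℚ ≤ g ⟪ lift (x i (c i)) ⟫
      1≤g⟪lift-x⟫ i = begin
        1ℚ                                                            ≡⟨ one ⟩
        0ℚ + (1ℚ * fromℕ 2 + 1ℚ * - 1ℚ)                               ≤⟨ +-monoʳ-≤ 0ℚ (+-mono-≤ (*-monoˡ-≤-0≤ (0≤fromℕ 1) (linear-g-ideal i))
                                                                                                (*-monoˡ-≤-0≤ (0≤fromℕ 1) (-1≤linear-g-w (just (i , c i))))) ⟩
        0ℚ + (1ℚ * linear g (ideal i (c i)) + 1ℚ * linear g (lift (w (just (i , c i)))))
                                                                      ≡⟨ cong (0ℚ +_) (linear-combination g 1ℚ 1ℚ (ideal i (c i)) (lift (w (just (i , c i))))) ⟨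
        0ℚ + linear g (λ k → 1ℚ * ideal i (c i) k + 1ℚ * lift (w (just (i , c i))) k)
                                                                      ≡⟨ cong (0ℚ +_) (sum-cong-≗ (λ k → cong (χ k *_)
                                                                           (trans (lift-x i (c i) k) (ones (ideal i (c i) k) (lift (w (just (i , c i))) k))))) ⟨
        g ⟪ lift (x i (c i)) ⟫                                        ∎
        where
        open ≤-Reasoning
        one : 1ℚ ≡ 0ℚ + (1ℚ * fromℕ 2 + 1ℚ * - 1ℚ)
        one = refl
        ones : ∀ a b → a + b ≡ 1ℚ * a + 1ℚ * b
        ones = solve-∀ ℚ-ring

      p∉Conv : ¬ (p ∈Conv (λ i → x i (c i)))
      p∉Conv (λs , 0≤λ , ∑λ≡1 , ∑λx≡p) = <-irrefl refl (≤-<-trans 1≤0 (*<* (ℤ.+<+ (s≤s z≤n))))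
        where
        open import Data.Rational using (*<*)
        lifted : ∀ k → ∑[ i < n ] (λs i * lift (x i (c i)) k) ≡ lift p k
        lifted = lift-combination λs (λ i → x i (c i)) (λ t → trans (sym (∑≡sum (λ i → λs i * x i (c i) t))) (∑λx≡p t))
        1≤0 : 1ℚ ≤ 0ℚ
        1≤0 = begin
          1ℚ                                           ≡⟨ trans (sym (∑≡sum λs)) ∑λ≡1 ⟨
          sum λs                                       ≡⟨ sum-cong-≗ (*-identityʳ ∘ λs) ⟨
          ∑[ i < n ] (λs i * 1ℚ)                       ≤⟨ sum-mono-≤ (λ i → *-monoˡ-≤-0≤ (0≤λ i) (1≤g⟪lift-x⟫ i)) ⟩
          ∑[ i < n ] (λs i * g ⟪ lift (x i (c i)) ⟫)    ≡⟨ ⟪⟫-combination g λs (λ i → lift (x i (c i))) lifted ⟩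
          sum λs * 0ℚ + linear g (lift p)
            ≡⟨ cong₂ _+_ (*-zeroʳ (sum λs)) (sum-cong-≗ (λ k → trans (cong (χ k *_) (lift-0 k)) (*-zeroʳ (χ k)))) ⟩
          0ℚ + ∑[ k < n ] 0ℚ                           ≡⟨ trans (+-identityˡ _) (sum-replicate-zero n) ⟩
          0ℚ                                           ∎
          where open ≤-Reasoning

    s A : ℚ
    s = 1/ℕ S
    A = fromℕ S - K * fromℕ d

    -- Barycentric coordinates with respect to the simplex ideal i; A is the i-th coordinate of ideal i k, k ≠ i.
    fα : Fin n → AffineForm n
    fα i = form₂ (A * s) (- s) i 0ℚ i

    fβ : Fin n → Fin n → AffineForm n
    fβ i j = form₂ (K * s) ι j ((K + K) * s * ι) i

    barycentric : Fin n → Fin n → AffineForm n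
    barycentric i j with i Fin.≟ j
    ... | yes _ = fα i
    ... | no  _ = fβ i j

    V-same : ∀ i → V i i ≡ fromℕ d
    V-same i = trans (cong (λ δᵢᵢ → fromℕ n * δᵢᵢ - 1ℚ) (δ-refl i))
                     (trans (cong (λ N → N * 1ℚ - 1ℚ) (fromℕ-homo-+ 1 d)) (cancel (fromℕ d)))
      where
      cancel : ∀ d → (1ℚ + d) * 1ℚ - 1ℚ ≡ d
      cancel = solve-∀ ℚ-ring

    V-other : ∀ {i k} → i ≢ k → V i k ≡ - 1ℚ
    V-other {i} {k} i≢k = trans (cong (λ δᵢₖ → fromℕ n * δᵢₖ - 1ℚ) (δ-≢ i≢k)) (vanish (fromℕ n))
      where
      vanish : ∀ N → N * 0ℚ - 1ℚ ≡ - 1ℚ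
      vanish = solve-∀ ℚ-ring

    Ss≡1 : fromℕ S * s ≡ 1ℚ
    Ss≡1 = n*1/n≡1 S

    nι≡1 : fromℕ n * ι ≡ 1ℚ
    nι≡1 = n*1/n≡1 n

    ideal-other-at-i : ∀ {i k} → i ≢ k → ideal i k i ≡ A
    ideal-other-at-i {i} {k} i≢k = begin
      ideal i k i                               ≡⟨ ideal-off (i≢k ∘ sym) i ⟩
      (K - 1ℚ) * V i i + V k i                  ≡⟨ cong₂ (λ a b → (K - 1ℚ) * a + b) (V-same i) (V-other (i≢k ∘ sym)) ⟩
      (K - 1ℚ) * fromℕ d + - 1ℚ                 ≡⟨ regroup K (fromℕ d) (fromℕ S) (fromℕ n) ⟩
      fromℕ S - K * fromℕ d + ((K + K) * fromℕ d - (fromℕ S + fromℕ n)) + (fromℕ n - (1ℚ + fromℕ d))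
                                                ≡⟨ cong₂ (λ a b → fromℕ S - K * fromℕ d + ((K + K) * fromℕ d - a) + (b - (1ℚ + fromℕ d)))
                                                         S+n≡2Kd (fromℕ-homo-+ 1 d) ⟩
      fromℕ S - K * fromℕ d + ((K + K) * fromℕ d - (K + K) * fromℕ d) + ((1ℚ + fromℕ d) - (1ℚ + fromℕ d))
                                                ≡⟨ vanish (fromℕ S - K * fromℕ d) ((K + K) * fromℕ d) (1ℚ + fromℕ d) ⟩
      A                                         ∎
      where
      open ≡-Reasoning
      regroup : ∀ K d S N → (K - 1ℚ) * d + - 1ℚ ≡ S - K * d + ((K + K) * d - (S + N)) + (N - (1ℚ + d))
      regroup = solve-∀ ℚ-ring
      vanish : ∀ a x y → a + (x - x) + (y - y) ≡ a
      vanish = solve-∀ ℚ-ring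

    ideal-other-elsewhere : ∀ {i k j} → i ≢ k → i ≢ j → ideal i k j ≡ (K - 1ℚ) * - 1ℚ + (fromℕ n * δ k j - 1ℚ)
    ideal-other-elsewhere {i} {k} {j} i≢k i≢j = trans (ideal-off (i≢k ∘ sym) j) (cong (λ v → (K - 1ℚ) * v + V k j) (V-other i≢j))

    barycentric-biorthogonal : ∀ i j k → barycentric i j ⟪ ideal i k ⟫ ≡ δ j k
    barycentric-biorthogonal i j k with i Fin.≟ j | i Fin.≟ k
    ... | yes refl | yes refl = begin
      fα i ⟪ ideal i i ⟫                          ≡⟨ form₂-⟪⟫ (A * s) (- s) i 0ℚ i (ideal i i) ⟩
      A * s + - s * ideal i i i + 0ℚ * ideal i i i
        ≡⟨ cong (λ y → A * s + - s * y + 0ℚ * y) (trans (ideal-diag i i) (cong (λ v → - (K * v)) (V-same i))) ⟩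
      A * s + - s * - (K * fromℕ d) + 0ℚ * - (K * fromℕ d) ≡⟨ regroup (fromℕ S) K (fromℕ d) s ⟩
      fromℕ S * s                                 ≡⟨ Ss≡1 ⟩
      1ℚ                                          ≡⟨ δ-refl i ⟨
      δ i i                                       ∎
      where
      open ≡-Reasoning
      regroup : ∀ S K d s → (S - K * d) * s + - s * - (K * d) + 0ℚ * - (K * d) ≡ S * s
      regroup = solve-∀ ℚ-ring
    ... | yes refl | no i≢k = begin
      fα i ⟪ ideal i k ⟫                          ≡⟨ form₂-⟪⟫ (A * s) (- s) i 0ℚ i (ideal i k) ⟩
      A * s + - s * ideal i k i + 0ℚ * ideal i k i ≡⟨ cong (λ y → A * s + - s * y + 0ℚ * y) (ideal-other-at-i i≢k) ⟩
      A * s + - s * A + 0ℚ * A                    ≡⟨ vanish A s ⟩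
      0ℚ                                          ≡⟨ δ-≢ i≢k ⟨
      δ i k                                       ∎
      where
      open ≡-Reasoning
      vanish : ∀ A s → A * s + - s * A + 0ℚ * A ≡ 0ℚ
      vanish = solve-∀ ℚ-ring
    ... | no i≢j | yes refl = begin
      fβ i j ⟪ ideal i i ⟫                        ≡⟨ form₂-⟪⟫ (K * s) ι j ((K + K) * s * ι) i (ideal i i) ⟩
      K * s + ι * ideal i i j + (K + K) * s * ι * ideal i i i
        ≡⟨ cong₂ (λ a b → K * s + ι * a + (K + K) * s * ι * b)
                 (trans (ideal-diag i j) (cong (λ v → - (K * v)) (V-other i≢j)))
                 (trans (ideal-diag i i) (cong (λ v → - (K * v)) (V-same i))) ⟩
      K * s + ι * - (K * - 1ℚ) + (K + K) * s * ι * - (K * fromℕ d)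
        ≡⟨ regroup K s ι (fromℕ n) (fromℕ S) (fromℕ d) ⟩
      K * s * (1ℚ - fromℕ n * ι) + K * ι * (1ℚ - fromℕ S * s) + K * s * ι * (fromℕ S + fromℕ n - (K + K) * fromℕ d)
        ≡⟨ cong₃ (λ a b c → K * s * (1ℚ - a) + K * ι * (1ℚ - b) + K * s * ι * (c - (K + K) * fromℕ d)) nι≡1 Ss≡1 S+n≡2Kd ⟩
      K * s * (1ℚ - 1ℚ) + K * ι * (1ℚ - 1ℚ) + K * s * ι * ((K + K) * fromℕ d - (K + K) * fromℕ d)
        ≡⟨ vanish K s ι ((K + K) * fromℕ d) ⟩
      0ℚ                                          ≡⟨ δ-≢ (i≢j ∘ sym) ⟨
      δ j i                                       ∎
      where
      open ≡-Reasoning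
      regroup : ∀ K s ι N S d → K * s + ι * - (K * - 1ℚ) + (K + K) * s * ι * - (K * d)
                               ≡ K * s * (1ℚ - N * ι) + K * ι * (1ℚ - S * s) + K * s * ι * (S + N - (K + K) * d)
      regroup = solve-∀ ℚ-ring
      vanish : ∀ K s ι x → K * s * (1ℚ - 1ℚ) + K * ι * (1ℚ - 1ℚ) + K * s * ι * (x - x) ≡ 0ℚ
      vanish = solve-∀ ℚ-ring
    ... | no i≢j | no i≢k = begin
      fβ i j ⟪ ideal i k ⟫                        ≡⟨ form₂-⟪⟫ (K * s) ι j ((K + K) * s * ι) i (ideal i k) ⟩
      K * s + ι * ideal i k j + (K + K) * s * ι * ideal i k i
        ≡⟨ cong₂ (λ a b → K * s + ι * a + (K + K) * s * ι * b) (ideal-other-elsewhere i≢k i≢j) (ideal-other-at-i i≢k) ⟩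
      K * s + ι * ((K - 1ℚ) * - 1ℚ + (fromℕ n * δ k j - 1ℚ)) + (K + K) * s * ι * (fromℕ S - K * fromℕ d)
        ≡⟨ regroup K s ι (fromℕ n) (fromℕ S) (fromℕ d) (δ k j) ⟩
      δ k j + δ k j * (fromℕ n * ι - 1ℚ) + K * s * (1ℚ - fromℕ n * ι) + K * ι * (fromℕ S * s - 1ℚ)
        + K * s * ι * (fromℕ S + fromℕ n - (K + K) * fromℕ d)
        ≡⟨ cong₃ (λ a b c → δ k j + δ k j * (a - 1ℚ) + K * s * (1ℚ - a) + K * ι * (b - 1ℚ) + K * s * ι * (c - (K + K) * fromℕ d))
                 nι≡1 Ss≡1 S+n≡2Kd ⟩
      δ k j + δ k j * (1ℚ - 1ℚ) + K * s * (1ℚ - 1ℚ) + K * ι * (1ℚ - 1ℚ) + K * s * ι * ((K + K) * fromℕ d - (K + K) * fromℕ d)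
        ≡⟨ vanish (δ k j) K s ι ((K + K) * fromℕ d) ⟩
      δ k j                                       ≡⟨ δ-sym k j ⟩
      δ j k                                       ∎
      where
      open ≡-Reasoning
      regroup : ∀ K s ι N S d δ → K * s + ι * ((K - 1ℚ) * - 1ℚ + (N * δ - 1ℚ)) + (K + K) * s * ι * (S - K * d)
                                 ≡ δ + δ * (N * ι - 1ℚ) + K * s * (1ℚ - N * ι) + K * ι * (S * s - 1ℚ) + K * s * ι * (S + N - (K + K) * d)
      regroup = solve-∀ ℚ-ring
      vanish : ∀ δ K s ι x → δ + δ * (1ℚ - 1ℚ) + K * s * (1ℚ - 1ℚ) + K * ι * (1ℚ - 1ℚ) + K * s * ι * (x - x) ≡ δ
      vanish = solve-∀ ℚ-ring

    0≤s : 0ℚ ≤ s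
    0≤s = 0≤1/ℕ S

    0≤K+K : 0ℚ ≤ K + K
    0≤K+K = +-mono-≤ 0≤K 0≤K

    B′≡1+2K : fromℕ B′ ≡ 1ℚ + (K + K)
    B′≡1+2K = trans (fromℕ-homo-+ 1 (4 ℕ.* suc n)) (cong (1ℚ +_) (trans (cong fromℕ (four n)) (fromℕ-homo-+ (2 ℕ.* suc n) (2 ℕ.* suc n))))
      where
      four : ∀ m → 4 ℕ.* suc m ≡ 2 ℕ.* suc m ℕ.+ 2 ℕ.* suc m
      four = ℕ-Solver.solve-∀

    ‖barycentric‖≤B′ : ∀ i j → ‖ barycentric i j ‖ ≤ fromℕ B′
    ‖barycentric‖≤B′ i j with i Fin.≟ j
    ... | yes _ = begin
      ‖ fα i ‖                ≤⟨ ‖form₂‖≤ (A * s) (- s) i 0ℚ i ⟩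
      ∣ - s ∣ + ∣ 0ℚ ∣        ≡⟨ trans (+-identityʳ _) (trans (∣-p∣≡∣p∣ s) (0≤p⇒∣p∣≡p 0≤s)) ⟩
      s                       ≤⟨ 1/ℕ≤1 S ⟩
      1ℚ                      ≡⟨ +-identityʳ 1ℚ ⟨
      1ℚ + 0ℚ                 ≤⟨ +-monoʳ-≤ 1ℚ 0≤K+K ⟩
      1ℚ + (K + K)            ≡⟨ B′≡1+2K ⟨
      fromℕ B′                ∎
      where open ≤-Reasoning
    ... | no _ = begin
      ‖ fβ i j ‖                                 ≤⟨ ‖form₂‖≤ (K * s) ι j ((K + K) * s * ι) i ⟩
      ∣ ι ∣ + ∣ (K + K) * s * ι ∣                ≡⟨ cong₂ _+_ (0≤p⇒∣p∣≡p 0≤ι) (0≤p⇒∣p∣≡p (0≤* (0≤* 0≤K+K 0≤s) 0≤ι)) ⟩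
      ι + (K + K) * s * ι                        ≤⟨ +-mono-≤ (1/ℕ≤1 n) (*-monoˡ-≤-0≤ (0≤* 0≤K+K 0≤s) (1/ℕ≤1 n)) ⟩
      1ℚ + (K + K) * s * 1ℚ                      ≤⟨ +-monoʳ-≤ 1ℚ (≤-trans (≤-reflexive (*-identityʳ _)) (*-monoˡ-≤-0≤ 0≤K+K (1/ℕ≤1 S))) ⟩
      1ℚ + (K + K) * 1ℚ                          ≡⟨ cong (1ℚ +_) (*-identityʳ (K + K)) ⟩
      1ℚ + (K + K)                               ≡⟨ B′≡1+2K ⟨
      fromℕ B′                                   ∎
      where
      open ≤-Reasoning
      0≤ι = 0≤1/ℕ n

    Kd+1≤S : K * fromℕ d + 1ℚ ≤ fromℕ S
    Kd+1≤S = begin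
      K * fromℕ d + 1ℚ                          ≡⟨ cong (_+ 1ℚ) (fromℕ-homo-* (2 ℕ.* suc n) d) ⟨
      fromℕ (2 ℕ.* suc n ℕ.* d) + fromℕ 1       ≡⟨ fromℕ-homo-+ (2 ℕ.* suc n ℕ.* d) 1 ⟨
      fromℕ (2 ℕ.* suc n ℕ.* d ℕ.+ 1)           ≤⟨ fromℕ-mono-≤ (ℕ.≤-trans (ℕ.m≤m+n _ (e ℕ.* (2 ℕ.* e ℕ.+ 7) ℕ.+ 3))
                                                                        (ℕ.≤-reflexive (sym (polynomial e)))) ⟩
      fromℕ S                                   ∎
      where
      open ≤-Reasoning
      polynomial : ∀ e → suc (e ℕ.* (4 ℕ.* e ℕ.+ 15) ℕ.+ 9)
                         ≡ 2 ℕ.* suc (suc (suc e)) ℕ.* suc e ℕ.+ 1 ℕ.+ (e ℕ.* (2 ℕ.* e ℕ.+ 7) ℕ.+ 3)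
      polynomial = ℕ-Solver.solve-∀

    s≤cs≤1 : ∀ {c} → 1ℚ ≤ c → c ≤ fromℕ S → s ≤ c * s × c * s ≤ 1ℚ
    s≤cs≤1 {c} 1≤c c≤S = ≤-trans (≤-reflexive (sym (*-identityˡ s))) (*-monoʳ-≤-0≤ 0≤s 1≤c) ,
                         ≤-trans (*-monoʳ-≤-0≤ 0≤s c≤S) (≤-reflexive Ss≡1)

    barycentric-at-0 : ∀ i j → s ≤ const (barycentric i j) × const (barycentric i j) ≤ 1ℚ
    barycentric-at-0 i j with i Fin.≟ j
    ... | yes _ = s≤cs≤1 (p+q≤r⇒p≤r-q {1ℚ} {K * fromℕ d} {fromℕ S} (≤-trans (≤-reflexive (+-comm 1ℚ (K * fromℕ d))) Kd+1≤S))
                         (≤-trans (+-monoʳ-≤ (fromℕ S) (neg-antimono-≤ (0≤* (0≤fromℕ (2 ℕ.* suc n)) (0≤fromℕ d))))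
                                  (≤-reflexive (+-identityʳ (fromℕ S))))
    ... | no _ = s≤cs≤1 (fromℕ-mono-≤ (s≤s z≤n)) (begin
      K                    ≡⟨ *-identityʳ K ⟨
      K * 1ℚ               ≤⟨ *-monoˡ-≤-0≤ 0≤K (fromℕ-mono-≤ {1} {d} (s≤s z≤n)) ⟩
      K * fromℕ d          ≡⟨ +-identityʳ (K * fromℕ d) ⟨
      K * fromℕ d + 0ℚ     ≤⟨ +-monoʳ-≤ (K * fromℕ d) (0≤fromℕ 1) ⟩
      K * fromℕ d + 1ℚ     ≤⟨ Kd+1≤S ⟩
      fromℕ S              ∎)
      where open ≤-Reasoning

    ε : ℚ
    ε = 1/ℕ (B′ ℕ.* d ℕ.* (2 ℕ.* S))

    ½s : 1/ℕ (2 ℕ.* S) ≡ ½ * s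
    ½s = 1/ℕ-homo-* 2 S

    ∣lift-Q∣≤dε : ∀ Q → (∀ t → ∣ Q t - p t ∣ < ε) → ∀ k → ∣ lift Q k - lift p k ∣ ≤ fromℕ d * ε
    ∣lift-Q∣≤dε Q Q≈p k = ≤-trans (≤-reflexive (cong ∣_∣ (trans (cong (λ l → lift Q k - l) (lift-0 k)) (+-identityʳ (lift Q k)))))
                                  (bound k)
      where
      ∣Q∣≤ε : ∀ t → ∣ Q t ∣ ≤ ε
      ∣Q∣≤ε t = ≤-trans (≤-reflexive (cong ∣_∣ (sym (+-identityʳ (Q t))))) (<⇒≤ (Q≈p t))
      bound : ∀ k → ∣ lift Q k ∣ ≤ fromℕ d * ε
      bound zero    = ≤-trans (≤-reflexive (∣-p∣≡∣p∣ (sum Q))) (≤-trans (∣sum∣≤sum∣∣ Q) (sum-≤-const ε ∣Q∣≤ε))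
      bound (suc t) = ≤-trans (∣Q∣≤ε t) (≤-trans (≤-reflexive (sym (*-identityˡ ε)))
                                                (*-monoʳ-≤-0≤ (0≤1/ℕ _) (fromℕ-mono-≤ {1} {d} (s≤s z≤n))))

    module _ (Q : Point d) (Q≈p : ∀ t → ∣ Q t - p t ∣ < ε) (i j : Fin n) where

      private
        f = barycentric i j

      deviation : ∣ f ⟪ lift Q ⟫ - const f ∣ ≤ ½ * s
      deviation = begin
        ∣ f ⟪ lift Q ⟫ - const f ∣                  ≡⟨ cong (λ c → ∣ f ⟪ lift Q ⟫ - c ∣) (⟪⟫-at-0 f lift-0) ⟨
        ∣ f ⟪ lift Q ⟫ - f ⟪ lift p ⟫ ∣             ≤⟨ ⟪⟫-lipschitz f {lift Q} {lift p} (∣lift-Q∣≤dε Q Q≈p) ⟩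
        ‖ f ‖ * (fromℕ d * ε)                      ≤⟨ *-monoʳ-≤-0≤ (0≤* (0≤fromℕ d) (0≤1/ℕ _)) (‖barycentric‖≤B′ i j) ⟩
        fromℕ B′ * (fromℕ d * ε)                   ≡⟨ fromℕ-*-assoc B′ d ε ⟩
        fromℕ (B′ ℕ.* d) * ε                       ≡⟨ *-1/ℕ-cancel (B′ ℕ.* d) (2 ℕ.* S) ⟩
        1/ℕ (2 ℕ.* S)                              ≡⟨ ½s ⟩
        ½ * s                                      ∎
        where open ≤-Reasoning

      ∣value∣≤2 : ∣ f ⟪ lift Q ⟫ ∣ ≤ fromℕ 2
      ∣value∣≤2 = begin
        ∣ f ⟪ lift Q ⟫ ∣                               ≡⟨ cong ∣_∣ (split (f ⟪ lift Q ⟫) (const f)) ⟩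
        ∣ const f + (f ⟪ lift Q ⟫ - const f) ∣          ≤⟨ ∣p+q∣≤∣p∣+∣q∣ (const f) _ ⟩
        ∣ const f ∣ + ∣ f ⟪ lift Q ⟫ - const f ∣
          ≤⟨ +-mono-≤ ∣const∣≤1 (≤-trans deviation (≤-trans (≤-reflexive (sym ½s)) (1/ℕ≤1 (2 ℕ.* S)))) ⟩
        1ℚ + 1ℚ                                        ≡⟨ fromℕ-homo-+ 1 1 ⟨
        fromℕ 2                                        ∎
        where
        open ≤-Reasoning
        split : ∀ v c → v ≡ c + (v - c)
        split = solve-∀ ℚ-ring
        ∣const∣≤1 : ∣ const f ∣ ≤ 1ℚ
        ∣const∣≤1 = ≤-trans (≤-reflexive (0≤p⇒∣p∣≡p (≤-trans 0≤s (proj₁ (barycentric-at-0 i j))))) (proj₂ (barycentric-at-0 i j))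

      margin : (fromℕ n * fromℕ 2 + fromℕ n * fromℕ 2) * (fromℕ B′ * η) ≤ f ⟪ lift Q ⟫
      margin = begin
        (fromℕ n * fromℕ 2 + fromℕ n * fromℕ 2) * (fromℕ B′ * η)
          ≡⟨ cong (_* (fromℕ B′ * η)) (trans (fromℕ-homo-+ (n ℕ.* 2) (n ℕ.* 2)) (cong₂ _+_ (fromℕ-homo-* n 2) (fromℕ-homo-* n 2))) ⟨
        fromℕ (n ℕ.* 2 ℕ.+ n ℕ.* 2) * (fromℕ B′ * η)
          ≡⟨ fromℕ-*-assoc (n ℕ.* 2 ℕ.+ n ℕ.* 2) B′ η ⟩
        fromℕ ((n ℕ.* 2 ℕ.+ n ℕ.* 2) ℕ.* B′) * η
          ≡⟨ *-1/ℕ-cancel ((n ℕ.* 2 ℕ.+ n ℕ.* 2) ℕ.* B′) (2 ℕ.* S) ⟩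
        1/ℕ (2 ℕ.* S)                     ≡⟨ ½s ⟩
        ½ * s                             ≡⟨ halves s ⟩
        s - ½ * s                         ≤⟨ +-monoˡ-≤ (- (½ * s)) (proj₁ (barycentric-at-0 i j)) ⟩
        const f - ½ * s                   ≤⟨ ∣p-q∣≤r⇒q-r≤p deviation ⟩
        f ⟪ lift Q ⟫                      ∎
        where
        open ≤-Reasoning
        halves : ∀ s → ½ * s ≡ s - ½ * s
        halves = solve-∀ ℚ-ring

    small : fromℕ n * (fromℕ B′ * η) ≤ ½
    small = begin
      fromℕ n * (fromℕ B′ * η)    ≡⟨ fromℕ-*-assoc n B′ η ⟩
      fromℕ (n ℕ.* B′) * η        ≤⟨ a*c≤b⇒a/b≤1/c (n ℕ.* B′) Rη 2 n*B′*2≤Rη ⟩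
      ½                           ∎
      where
      open ≤-Reasoning
      swap : ∀ n b → n ℕ.* b ℕ.* 2 ≡ n ℕ.* 2 ℕ.* b
      swap = ℕ-Solver.solve-∀
      n*B′*2≤Rη : n ℕ.* B′ ℕ.* 2 ℕ.≤ Rη
      n*B′*2≤Rη = ℕ.≤-trans (ℕ.≤-reflexive (swap n B′))
                    (ℕ.≤-trans (ℕ.*-monoˡ-≤ B′ (ℕ.m≤m+n (n ℕ.* 2) (n ℕ.* 2)))
                               (ℕ.m≤m*n ((n ℕ.* 2 ℕ.+ n ℕ.* 2) ℕ.* B′) (2 ℕ.* S)))

    x≈ideal : ∀ i k t → ∣ lift (x i k) t - ideal i k t ∣ ≤ η
    x≈ideal i k t = ≤-trans (≤-reflexive (cong ∣_∣ (trans (cong (_- ideal i k t) (lift-x i k t)) (cancel (ideal i k t) _))))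
                            (∣lift-w∣≤η (just (i , k)) t)
      where
      cancel : ∀ a b → a + b - a ≡ b
      cancel = solve-∀ ℚ-ring

    interior : InInteriorOfCore p x
    interior = ε , positive⁻¹ ε , λ Q Q≈p i →
      perturbed-simplex-contains (x i) (ideal i) (barycentric i) (0≤fromℕ B′) (0≤1/ℕ Rη) (‖barycentric‖≤B′ i)
        (barycentric-biorthogonal i) (x≈ideal i) small Q (∣value∣≤2 Q Q≈p i) (margin Q Q≈p i)

    generalPosition-withPoint : GeneralPosition (withPoint p x)
    generalPosition-withPoint = GeneralPosition-cong withPoint≡z generalPosition

  -- Counting the colourful simplices
  module _ {A : Set} where

    length-cartesianProductWith : ∀ {B C : Set} (f : A → B → C) xs ys →
                                  length (cartesianProductWith f xs ys) ≡ length xs ℕ.* length ys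
    length-cartesianProductWith f []       ys = refl
    length-cartesianProductWith f (x ∷ xs) ys = trans (length-++ (List.map (f x) ys))
      (cong₂ ℕ._+_ (length-map (f x) ys) (length-cartesianProductWith f xs ys))

    vectors : ∀ m → (Fin m → List A) → List (Vec A m)
    vectors zero    S = [] ∷ []
    vectors (suc m) S = cartesianProductWith _∷_ (S zero) (vectors m (S ∘ suc))

    ∈-vectors⁺ : ∀ m (S : Fin m → List A) (c : Vec A m) → (∀ i → lookup c i ∈ S i) → c ∈ vectors m S
    ∈-vectors⁺ zero    S []      _   = here refl
    ∈-vectors⁺ (suc m) S (a ∷ c) c∈S = ∈-cartesianProductWith⁺ _∷_ (c∈S zero) (∈-vectors⁺ m (S ∘ suc) c (c∈S ∘ suc))

    ∈-vectors⁻ : ∀ m (S : Fin m → List A) (c : Vec A m) → c ∈ vectors m S → ∀ i → lookup c i ∈ S i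
    ∈-vectors⁻ (suc m) S (a ∷ c) a∷c∈ i with ∈-cartesianProductWith⁻ _∷_ (S zero) (vectors m (S ∘ suc)) a∷c∈
    ... | a′ , c′ , a′∈ , c′∈ , a∷c≡a′∷c′ with ∷-injective a∷c≡a′∷c′
    ∈-vectors⁻ (suc m) S (a ∷ c) a∷c∈ zero    | _ , _ , a∈ , _  , _ | refl , refl = a∈
    ∈-vectors⁻ (suc m) S (a ∷ c) a∷c∈ (suc i) | _ , _ , _  , c∈ , _ | refl , refl = ∈-vectors⁻ m (S ∘ suc) c c∈ i

    vectors-unique : ∀ m (S : Fin m → List A) → (∀ i → Unique (S i)) → Unique (vectors m S)
    vectors-unique zero    S _        = [] ∷ []
    vectors-unique (suc m) S S-unique =
      Unique.cartesianProductWith⁺ _∷_ ∷-injective (S-unique zero) (vectors-unique m (S ∘ suc) (S-unique ∘ suc))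

    length-vectors : ∀ m (S : Fin m → List A) k → (∀ i → length (S i) ≡ k) → length (vectors m S) ≡ k ℕ.^ m
    length-vectors zero    S k _        = refl
    length-vectors (suc m) S k length≡k = trans (length-cartesianProductWith _∷_ (S zero) (vectors m (S ∘ suc)))
      (cong₂ ℕ._*_ (length≡k zero) (length-vectors m (S ∘ suc) k (length≡k ∘ suc)))

  allExcept : ∀ {d} → Fin (suc d) → List (Fin (suc d))
  allExcept {d} i = List.map (punchIn i) (List.allFin d)

  ∈-allExcept⁺ : ∀ {d} {i a : Fin (suc d)} → a ≢ i → a ∈ allExcept i
  ∈-allExcept⁺ {i = i} a≢i = subst (_∈ allExcept i) (punchIn-punchOut (a≢i ∘ sym)) (∈-map⁺ (punchIn i) (∈-allFin _))

  ∈-allExcept⁻ : ∀ {d} {i a : Fin (suc d)} → a ∈ allExcept i → a ≢ i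
  ∈-allExcept⁻ {i = i} a∈ with ∈-map⁻ (punchIn i) a∈
  ... | j , _ , refl = punchInᵢ≢i i j

  length-allExcept : ∀ {d} (i : Fin (suc d)) → length (allExcept i) ≡ d
  length-allExcept {d} i = trans (length-map (punchIn i) (List.allFin d)) (length-tabulate id)

  allExcept-unique : ∀ {d} (i : Fin (suc d)) → Unique (allExcept i)
  allExcept-unique {d} i = Unique.map⁺ (punchIn-injective i _ _) (Unique.allFin⁺ d)

  fixedPoint-trichotomy : ∀ {n} (c : Fin n → Fin n) →
    (∀ i → c i ≢ i) ⊎ (∀ i → c i ≡ i) ⊎ ((∃ λ i₁ → c i₁ ≡ i₁) × (∃ λ i₂ → c i₂ ≢ i₂))
  fixedPoint-trichotomy {n} c with all? (λ i → ¬? (c i Fin.≟ i)) | all? (λ i → c i Fin.≟ i)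
  ... | yes none-fixed | _         = inj₁ none-fixed
  ... | no _           | yes all-fixed = inj₂ (inj₁ all-fixed)
  ... | no some-fixed  | no some-moved = inj₂ (inj₂ (fixed , ¬∀⟶∃¬ n _ (λ i → c i Fin.≟ i) some-moved))
    where
    fixed : ∃ λ i₁ → c i₁ ≡ i₁
    fixed with ¬∀⟶∃¬ n _ (λ i → ¬? (c i Fin.≟ i)) some-fixed
    ... | i₁ , ¬¬fixed = i₁ , decidable-stable (c i₁ Fin.≟ i₁) ¬¬fixed

  module Colourings (e : ℕ) where
    open Configuration e

    colourings : List (Vec (Fin n) n)
    colourings = vectors n allExcept ++ allFin n ∷ []

    colourings-unique : Unique colourings
    colourings-unique = Unique.++⁺ (vectors-unique n allExcept allExcept-unique) ([] ∷ [])
      λ { (id∈vectors , here refl) → ∈-allExcept⁻ (∈-vectors⁻ n allExcept (allFin n) id∈vectors zero) refl }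

    length-colourings : length colourings ≡ d ℕ.^ n ℕ.+ 1
    length-colourings = trans (length-++ (vectors n allExcept)) (cong (ℕ._+ 1) (length-vectors n allExcept d length-allExcept))

    -- The case splits use eliminators rather than `with`: abstracting over the goal would normalise the
    -- points x, whose denominator contains a factorial.
    ∈colourings⇔contains : ∀ c → (c ∈ colourings) ⇔ (p ∈Conv (λ i → x i (lookup c i)))
    ∈colourings⇔contains c = mk⇔ to from
      where
      to : c ∈ colourings → p ∈Conv (λ i → x i (lookup c i))
      to c∈ = [ (λ c∈vectors → derangement-contains (lookup c) (λ i → ∈-allExcept⁻ (∈-vectors⁻ n allExcept c c∈vectors i)))
              , (λ { (here refl) → identity-contains (lookup c) lookup-allFin }) ]′ (∈-++⁻ (vectors n allExcept) c∈)
      from : p ∈Conv (λ i → x i (lookup c i)) → c ∈ colourings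
      from p∈ = [ (λ none-fixed → ∈-++⁺ˡ (∈-vectors⁺ n allExcept c (λ i → ∈-allExcept⁺ (none-fixed i))))
                , [ (λ all-fixed → ∈-++⁺ʳ (vectors n allExcept) (here (trans (sym (tabulate∘lookup c)) (tabulate-cong all-fixed))))
                  , (λ { ((_ , fixed) , (_ , moved)) → ⊥-elim (Mixed.p∉Conv (lookup c) fixed moved p∈) }) ]′ ]′
                (fixedPoint-trichotomy (lookup c))

open import Data.Nat using (ℕ; zero; suc; _+_; _^_; _≤_)
open import Data.Fin using (Fin)
open import Data.Vec using (Vec; lookup)
open import Data.List using (List; length)
open import Data.List.Membership.Propositional using (_∈_)
open import Data.List.Relation.Unary.Unique.Propositional using (Unique)
open import Data.Maybe using (Maybe; just; nothing)
open import Data.Product using (Σ; _×_; _,_; uncurry)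
open import Function.Bundles using (_⇔_)
open import Relation.Binary.PropositionalEquality using (_≡_)

mainTheorem9 : ∀ (d : ℕ) → 1 ≤ d →
    Σ (Fin (suc d) → Fin (suc d) → Point d) λ x →
    Σ (Point d) λ p →
      InInteriorOfCore p x ×
      GeneralPosition {d} {Maybe (Fin (suc d) × Fin (suc d))}
        (withPoint p x) ×
      Σ (List (Vec (Fin (suc d)) (suc d))) λ L →
        Unique L × (length L ≡ d ^ (suc d) + 1) ×
        (∀ c → (c ∈ L) ⇔ (p ∈Conv (λ i → x i (lookup c i))))
mainTheorem9 zero    ()
mainTheorem9 (suc e) _ =
  x , p , interior , generalPosition-withPoint ,
  colourings , colourings-unique , length-colourings , ∈colourings⇔contains
  where
  open RationalGeometry.Configuration e
  open RationalGeometry.Colourings e
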